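{- Let $q$ be a prime power and $2\le\ell\le m$ integers. For $1\le r\le\ell m$ let $\hat d_r$ denote the $r$-th generalized Hamming weight of $\hat C_{\det}(1;\ell,m)$, and recall $\hat d_m=q^{\ell-1}\frac{q^m-1}{q-1}$. Then for $r=m+1,\dots,\ell m$, $$\hat d_r\ge q^{\ell+m-r-1}\left(\frac{q^r-1}{q-1}+q^{r-2}-1\right)=\hat d_m+q^{\ell+m-r-1}\left(\frac{q^{r-m}-1}{q-1}+q^{r-2}-1\right).$$ Moreover equality holds when $r=m+1$, so that $\hat d_{m+1}=\hat d_m+q^{\ell+m-3}$.
   Context: $\mathbb{F}_q$ is the finite field with $q$ elements; $X=(X_{ij})$ is an $\ell\times m$ matrix of indeterminates; $\mathbb{F}_q[X]_1$ is the space of linear homogeneous polynomials $f=\sum f_{ij}X_{ij}$ (with $0$), evaluated at a matrix $M$ by $f(M)=\sum f_{ij}M_{ij}$. Let $\hat M_1,\dots,\hat M_{\hat n}$ be representatives, one from each class of nonzero scalar multiples, of the matrices in $M_{\ell\times m}(\mathbb{F}_q)$ of rank exactly $1$; $\hat C_{\det}(1;\ell,m)=\{(f(\hat M_1),\dots,f(\hat M_{\hat n})):f\in\mathbb{F}_q[X]_1\}$. For a code $C$, the support weight of a subcode $D$ is $\|D\|=|\{i:\exists c\in D,\ c_i\neq0\}|$ and $d_r(C)=\min\{\|D\|:D\subseteq C,\ \dim D=r\}$. -}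

module Defs where

open import Data.Nat using (ℕ; zero; suc; _≤_)
open import Data.Fin using (Fin; zero; suc)
open import Data.Fin.Subset using (Subset; _∈_; ∣_∣)
open import Data.Product using (Σ; Σ-syntax; _×_)
open import Relation.Nullary using (¬_)
open import Relation.Binary.PropositionalEquality using (_≡_)
open import Algebra.Structures using (IsCommutativeRing)
open import Function.Bundles using (Inverse)
open import Relation.Binary.PropositionalEquality using (setoid)
open import Data.Fin.Properties using ()

record FiniteField : Set₁ where
  infixl 6 _+_
  infixl 7 _*_
  field
    Carrier  : Set
    _+_ _*_  : Carrier → Carrier → Carrier
    -_       : Carrier → Carrier
    0F 1F    : Carrier
    isCommutativeRing : IsCommutativeRing _≡_ _+_ _*_ -_ 0F 1F
    0≢1      : ¬ (0F ≡ 1F)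
    inverse  : ∀ x → ¬ (x ≡ 0F) → Σ Carrier (λ y → x * y ≡ 1F)
    size     : ℕ
    enum     : Inverse (setoid Carrier) (setoid (Fin size))

module Code (F : FiniteField) where
  open FiniteField F

  sumF : ∀ {n} → (Fin n → Carrier) → Carrier
  sumF {zero}  g = 0F
  sumF {suc n} g = g zero + sumF (λ i → g (suc i))

  -- ℓ × m matrices over F; also used as coefficient matrices of linear
  -- homogeneous polynomials f = Σ f_ij X_ij in F[X]_1
  Mat : ℕ → ℕ → Set
  Mat ℓ m = Fin ℓ → Fin m → Carrier

  eval : ∀ {ℓ m} → Mat ℓ m → Mat ℓ m → Carrier
  eval f M = sumF (λ i → sumF (λ j → f i j * M i j))

  RankOne : ∀ {ℓ m} → Mat ℓ m → Set
  RankOne M =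
    (Σ _ λ i → Σ _ λ j → ¬ (M i j ≡ 0F)) ×
    (∀ i i' j j' → M i j * M i' j' ≡ M i j' * M i' j)

  ScalarMultiple : ∀ {ℓ m} → Mat ℓ m → Mat ℓ m → Set
  ScalarMultiple M N =
    Σ Carrier λ c → ¬ (c ≡ 0F) × (∀ i j → M i j ≡ c * N i j)

  IsProjRankOneReps : ∀ ℓ m n → (Fin n → Mat ℓ m) → Set
  IsProjRankOneReps ℓ m n reps =
    (∀ k → RankOne (reps k)) ×
    (∀ M → RankOne M → Σ (Fin n) λ k → ScalarMultiple M (reps k)) ×
    (∀ k k' → ScalarMultiple (reps k) (reps k') → k ≡ k')

  module _ {ℓ m n : ℕ} (reps : Fin n → Mat ℓ m) where
    codeword : Mat ℓ m → Fin n → Carrier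
    codeword f k = eval f (reps k)

    -- r codewords (given by linear forms fs), spanning the subcode D
    -- linear combination Σ_t λ_t c_t
    combo : ∀ {r} → (Fin r → Mat ℓ m) → (Fin r → Carrier) → Fin n → Carrier
    combo fs λs k = sumF (λ t → λs t * codeword (fs t) k)

    LinIndep : ∀ {r} → (Fin r → Mat ℓ m) → Set
    LinIndep fs = ∀ λs → (∀ k → combo fs λs k ≡ 0F) → ∀ t → λs t ≡ 0F

    InSupport : ∀ {r} → (Fin r → Mat ℓ m) → Fin n → Set
    InSupport fs k = Σ _ λ λs → ¬ (combo fs λs k ≡ 0F)

    SupportWeight : ∀ {r} → (Fin r → Mat ℓ m) → ℕ → Set
    SupportWeight fs s =
      Σ (Subset n) λ S →
        (∀ k → (k ∈ S → InSupport fs k) × (InSupport fs k → k ∈ S)) ×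
        ∣ S ∣ ≡ s

    IsGHW : ℕ → ℕ → Set
    IsGHW r d =
      (Σ (Fin r → Mat ℓ m) λ fs → LinIndep fs × SupportWeight fs d) ×
      (∀ (fs : Fin r → Mat ℓ m) → LinIndep fs → ∀ s → SupportWeight fs s → d ≤ s)

{-# OPTIONS --safe #-}
-- Averaging over the q^r matrices M of an r-dimensional space D expresses the support weight
-- through the left kernels of the M, and a kernel shrinks by a factor q² instead of q as soon
-- as M has rank at least two.  So everything rests on D having few matrices of rank at most
-- one: their number N satisfies N + q ≤ q^(r-1) + q².  For a column u let D_u be the part of D
-- of the form u wᵀ, and A = |D_u|.  A coset x + D_u other than D_u contains at most q matrices
-- of rank at most one, because two of them differ by a multiple of u bᵀ, where bᵀ spans the
-- rows of one of them; hence A N ≤ A² + (q^r - A) q.  If some D_u has dimension at least two,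
-- then q² ≤ A ≤ q^m ≤ q^(r-1) and the bound follows by convexity.  Otherwise a nonzero matrix
-- of rank one in D is determined by a suitably normalised column, and N ≤ q^ℓ ≤ q^(r-1).
-- For r = m + 1 equality holds for the matrices supported in the first row together with one
-- matrix unit in the second row.
module Submission where

open import Defs
open import Algebra.Bundles using (CommutativeRing)
import Algebra.Properties.Ring
import Algebra.Solver.Ring.NaturalCoefficients.Default
open import Data.Bool using (true; false; if_then_else_)
open import Data.Fin using (Fin; zero; suc)
import Data.Fin.Properties as Fin
open import Data.Fin.Subset using (Subset; _∈_; ∣_∣)
open import Data.Fin.Subset.Properties using (_∈?_)
open import Data.List using (List; []; _∷_; [_]; map; _++_)
open import Data.Nat
  using (ℕ; zero; suc; _+_; _*_; _∸_; _^_; _≤_; z≤n; s≤s; NonZero; >-nonZero; >-nonZero⁻¹)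
open import Data.Nat.Properties hiding (_≟_)
open import Data.Nat.Tactic.RingSolver using (solve-∀)
open import Data.Product using (Σ; ∃; _×_; _,_; proj₁; proj₂)
open import Data.Product.Properties using (≡-dec)
open import Data.Sum using (_⊎_; inj₁; inj₂)
open import Data.Unit using (tt)
open import Data.Vec using (Vec; []; _∷_; lookup; replicate; tabulate; zipWith)
import Data.Vec as Vec
open import Data.Vec.Properties
  using (lookup-zipWith; lookup-map; lookup-replicate; lookup∘tabulate; lookup⇒[]=; []=⇒lookup)
open import Function using (_∘_)
open import Function.Bundles using (Inverse)
open import Relation.Binary.PropositionalEquality hiding ([_])
open import Relation.Nullary using (¬_; Dec; yes; no; does; contradiction)
open import Relation.Nullary.Decidable using (_×-dec_; ¬?; dec-true; dec-false)

-- Counting in finite types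

-- The coset count gives N + q ≤ A + q^(r+1)/A. The right side is convex in A, and the ends A = q²
-- and A = q^(r-1) of the admissible interval give it the same value q^(r-1) + q²; this is the
-- origin of that constant. The upper end is where r > m enters: for 3 ≤ r ≤ m all of D may have the
-- form u wᵀ, and then N = q^r violates the bound. The lower end needs two independent elements in
-- one D_u, which forces the separate case. The support weight is compared with pairs (u, v) of
-- vectors, not directly with the chosen representatives. Each representative accounts for (q - 1)²
-- pairs with u vᵀ proportional to it, and on pairs the form uᵀMv is linear in each of M, u and v,
-- so that the order of summation can be exchanged. The estimates live in the natural numbers:
-- denominators are cleared, and a term that would be subtracted is added to the other side.

𝟙 : {P : Set} → Dec P → ℕ
𝟙 P? = if does P? then 1 else 0

𝟙-yes : {P : Set} (P? : Dec P) → P → 𝟙 P? ≡ 1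
𝟙-yes P? p rewrite dec-true P? p = refl

𝟙-no : {P : Set} (P? : Dec P) → ¬ P → 𝟙 P? ≡ 0
𝟙-no P? ¬p rewrite dec-false P? ¬p = refl

𝟙≤1 : {P : Set} (P? : Dec P) → 𝟙 P? ≤ 1
𝟙≤1 (yes _) = ≤-refl
𝟙≤1 (no _)  = z≤n

𝟙-¬ : {P : Set} (P? : Dec P) → 𝟙 P? + 𝟙 (¬? P?) ≡ 1
𝟙-¬ (yes _) = refl
𝟙-¬ (no _)  = refl

𝟙-mono : {P Q : Set} (P? : Dec P) (Q? : Dec Q) → (P → Q) → 𝟙 P? ≤ 𝟙 Q?
𝟙-mono (yes p) Q? f = ≤-reflexive (sym (𝟙-yes Q? (f p)))
𝟙-mono (no _)  Q? f = z≤n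

𝟙-× : {P Q : Set} (P? : Dec P) (Q? : Dec Q) → 𝟙 (P? ×-dec Q?) ≡ 𝟙 P? * 𝟙 Q?
𝟙-× (yes _) (yes _) = refl
𝟙-× (yes _) (no _)  = refl
𝟙-× (no _)  _       = refl

𝟙-cong : {P Q : Set} (P? : Dec P) (Q? : Dec Q) → (P → Q) → (Q → P) → 𝟙 P? ≡ 𝟙 Q?
𝟙-cong P? Q? f g = ≤-antisym (𝟙-mono P? Q? f) (𝟙-mono Q? P? g)

∑ᴸ : {A : Set} → List A → (A → ℕ) → ℕ
∑ᴸ []       f = 0
∑ᴸ (x ∷ xs) f = f x + ∑ᴸ xs f

∑ᴸ-cong : ∀ {A : Set} (xs : List A) {f g} → (∀ x → f x ≡ g x) → ∑ᴸ xs f ≡ ∑ᴸ xs g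
∑ᴸ-cong []       f≡g = refl
∑ᴸ-cong (x ∷ xs) f≡g = cong₂ _+_ (f≡g x) (∑ᴸ-cong xs f≡g)

∑ᴸ-mono : ∀ {A : Set} (xs : List A) {f g} → (∀ x → f x ≤ g x) → ∑ᴸ xs f ≤ ∑ᴸ xs g
∑ᴸ-mono []       f≤g = z≤n
∑ᴸ-mono (x ∷ xs) f≤g = +-mono-≤ (f≤g x) (∑ᴸ-mono xs f≤g)

∑ᴸ-zero : ∀ {A : Set} (xs : List A) → ∑ᴸ xs (λ _ → 0) ≡ 0
∑ᴸ-zero []       = refl
∑ᴸ-zero (_ ∷ xs) = ∑ᴸ-zero xs

∑ᴸ-+ : ∀ {A : Set} (xs : List A) f g → ∑ᴸ xs (λ x → f x + g x) ≡ ∑ᴸ xs f + ∑ᴸ xs g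
∑ᴸ-+ []       f g = refl
∑ᴸ-+ (x ∷ xs) f g rewrite ∑ᴸ-+ xs f g = interchange (f x) (g x) (∑ᴸ xs f) (∑ᴸ xs g)
  where
  interchange : ∀ a b c d → a + b + (c + d) ≡ a + c + (b + d)
  interchange = solve-∀

∑ᴸ-*ˡ : ∀ {A : Set} (xs : List A) k f → ∑ᴸ xs (λ x → k * f x) ≡ k * ∑ᴸ xs f
∑ᴸ-*ˡ []       k f = sym (*-zeroʳ k)
∑ᴸ-*ˡ (x ∷ xs) k f rewrite ∑ᴸ-*ˡ xs k f = sym (*-distribˡ-+ k (f x) (∑ᴸ xs f))

∑ᴸ-++ : ∀ {A : Set} (xs ys : List A) f → ∑ᴸ (xs ++ ys) f ≡ ∑ᴸ xs f + ∑ᴸ ys f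
∑ᴸ-++ []       ys f = refl
∑ᴸ-++ (x ∷ xs) ys f rewrite ∑ᴸ-++ xs ys f = sym (+-assoc (f x) _ _)

∑ᴸ-swap : ∀ {A B : Set} (xs : List A) (ys : List B) (f : A → B → ℕ) →
  ∑ᴸ xs (λ x → ∑ᴸ ys (f x)) ≡ ∑ᴸ ys (λ y → ∑ᴸ xs (λ x → f x y))
∑ᴸ-swap []       ys f = sym (∑ᴸ-zero ys)
∑ᴸ-swap (x ∷ xs) ys f rewrite ∑ᴸ-swap xs ys f = sym (∑ᴸ-+ ys (f x) _)

∑ᴸ-map : ∀ {A B : Set} (h : B → A) (ys : List B) f → ∑ᴸ (map h ys) f ≡ ∑ᴸ ys (f ∘ h)
∑ᴸ-map h []       f = refl
∑ᴸ-map h (y ∷ ys) f = cong (f (h y) +_) (∑ᴸ-map h ys f)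

pairs : {A B : Set} → List A → List B → List (A × B)
pairs []       ys = []
pairs (x ∷ xs) ys = map (x ,_) ys ++ pairs xs ys

∑ᴸ-pairs : ∀ {A B : Set} (xs : List A) (ys : List B) (f : A × B → ℕ) →
  ∑ᴸ (pairs xs ys) f ≡ ∑ᴸ xs (λ x → ∑ᴸ ys (λ y → f (x , y)))
∑ᴸ-pairs []       ys f = refl
∑ᴸ-pairs (x ∷ xs) ys f = begin
  ∑ᴸ (map (x ,_) ys ++ pairs xs ys) f
    ≡⟨ ∑ᴸ-++ (map (x ,_) ys) (pairs xs ys) f ⟩
  ∑ᴸ (map (x ,_) ys) f + ∑ᴸ (pairs xs ys) f
    ≡⟨ cong₂ _+_ (∑ᴸ-map (x ,_) ys f) (∑ᴸ-pairs xs ys f) ⟩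
  ∑ᴸ ys (λ y → f (x , y)) + ∑ᴸ xs (λ x → ∑ᴸ ys (λ y → f (x , y))) ∎
  where open ≡-Reasoning

-- The single equation `once` contains both the completeness of the list and the absence of
-- repetitions, in the form in which sums use them.
record Finite (A : Set) : Set where
  infix 4 _≟_
  field
    _≟_      : (x y : A) → Dec (x ≡ y)
    elements : List A
    once     : ∀ a → ∑ᴸ elements (λ x → 𝟙 (x ≟ a)) ≡ 1

open Finite {{...}} using (_≟_)

∑ : {A : Set} {{_ : Finite A}} → (A → ℕ) → ℕ
∑ {{fin}} = ∑ᴸ (Finite.elements fin)

card : (A : Set) {{_ : Finite A}} → ℕ
card A = ∑ {A} (λ _ → 1)

count : {A : Set} {{_ : Finite A}} {P : A → Set} → (∀ a → Dec (P a)) → ℕ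
count P? = ∑ (λ a → 𝟙 (P? a))

module _ {A : Set} {{fin : Finite A}} where

  private
    xs = Finite.elements fin

  ∑-cong : ∀ {f g : A → ℕ} → (∀ x → f x ≡ g x) → ∑ f ≡ ∑ g
  ∑-cong = ∑ᴸ-cong xs

  ∑-mono : ∀ {f g : A → ℕ} → (∀ x → f x ≤ g x) → ∑ f ≤ ∑ g
  ∑-mono = ∑ᴸ-mono xs

  ∑-+ : ∀ (f g : A → ℕ) → ∑ (λ x → f x + g x) ≡ ∑ f + ∑ g
  ∑-+ = ∑ᴸ-+ xs

  ∑-*ˡ : ∀ k (f : A → ℕ) → ∑ (λ x → k * f x) ≡ k * ∑ f
  ∑-*ˡ = ∑ᴸ-*ˡ xs

  ∑-*ʳ : ∀ (f : A → ℕ) k → ∑ (λ x → f x * k) ≡ ∑ f * k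
  ∑-*ʳ f k = begin
    ∑ (λ x → f x * k) ≡⟨ ∑-cong (λ x → *-comm (f x) k) ⟩
    ∑ (λ x → k * f x) ≡⟨ ∑-*ˡ k f ⟩
    k * ∑ f           ≡⟨ *-comm k (∑ f) ⟩
    ∑ f * k           ∎
    where open ≡-Reasoning

  ∑-const : ∀ k → ∑ (λ (_ : A) → k) ≡ card A * k
  ∑-const k = trans (∑-cong (λ _ → sym (*-identityˡ k))) (∑-*ʳ (λ _ → 1) k)

  ∑-swap : ∀ {B : Set} {{_ : Finite B}} (f : A → B → ℕ) →
    ∑ (λ x → ∑ (f x)) ≡ ∑ (λ y → ∑ (λ x → f x y))
  ∑-swap {{finB}} = ∑ᴸ-swap xs (Finite.elements finB)

  ∑-δ : ∀ (g : A → ℕ) a → ∑ (λ x → 𝟙 (x ≟ a) * g x) ≡ g a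
  ∑-δ g a = begin
    ∑ (λ x → 𝟙 (x ≟ a) * g x) ≡⟨ ∑-cong at-a ⟩
    ∑ (λ x → 𝟙 (x ≟ a) * g a) ≡⟨ ∑-*ʳ _ (g a) ⟩
    ∑ (λ x → 𝟙 (x ≟ a)) * g a ≡⟨ cong (_* g a) (Finite.once fin a) ⟩
    1 * g a                   ≡⟨ *-identityˡ (g a) ⟩
    g a                       ∎
    where
    open ≡-Reasoning
    at-a : ∀ x → 𝟙 (x ≟ a) * g x ≡ 𝟙 (x ≟ a) * g a
    at-a x with x ≟ a
    ... | yes refl = refl
    ... | no _     = refl

  term≤∑ : ∀ (g : A → ℕ) a → g a ≤ ∑ g
  term≤∑ g a = subst (_≤ ∑ g) (∑-δ g a)
    (∑-mono (λ x → ≤-trans (*-monoˡ-≤ (g x) (𝟙≤1 (x ≟ a))) (≤-reflexive (*-identityˡ (g x)))))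

  -- List membership is never mentioned: a failed search makes the count zero, whereas an element
  -- satisfying `P` would contribute 1 to it by `term≤∑`.
  search : ∀ {P : A → Set} → (∀ a → Dec (P a)) → ∃ P ⊎ (∀ a → ¬ P a)
  search {P} P? with searchᴸ xs
    where
    searchᴸ : ∀ ys → ∃ P ⊎ ∑ᴸ ys (λ a → 𝟙 (P? a)) ≡ 0
    searchᴸ []       = inj₂ refl
    searchᴸ (y ∷ ys) with P? y
    ... | yes py = inj₁ (y , py)
    ... | no _   = searchᴸ ys
  ... | inj₁ found = inj₁ found
  ... | inj₂ none  = inj₂ λ a pa →
    1+n≰n (≤-trans (≤-reflexive (sym (𝟙-yes (P? a) pa)))
          (≤-trans (term≤∑ (λ x → 𝟙 (P? x)) a) (≤-reflexive none)))

  ∃? : ∀ {P : A → Set} → (∀ a → Dec (P a)) → Dec (∃ P)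
  ∃? P? with search P?
  ... | inj₁ found = yes found
  ... | inj₂ none  = no λ (a , pa) → none a pa

  module _ {P : A → Set} (P? : ∀ a → Dec (P a)) where

    count-¬ : count P? + count (λ a → ¬? (P? a)) ≡ card A
    count-¬ = trans (sym (∑-+ (λ a → 𝟙 (P? a)) (λ a → 𝟙 (¬? (P? a)))))
                    (∑-cong (λ a → 𝟙-¬ (P? a)))

    count-none : (∀ a → ¬ P a) → count P? ≡ 0
    count-none none = trans (∑-cong (λ a → 𝟙-no (P? a) (none a))) (∑ᴸ-zero xs)

    count-unique : {Q : Set} (Q? : Dec Q) → (∀ a → P a → Q) →
      (∀ a b → P a → P b → a ≡ b) → count P? ≤ 𝟙 Q?
    count-unique Q? P⇒Q unique with search P?
    ... | inj₁ (a , pa) = begin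
      count P?            ≤⟨ ∑-mono (λ b → 𝟙-mono (P? b) (b ≟ a) (λ pb → unique b a pb pa)) ⟩
      ∑ (λ b → 𝟙 (b ≟ a)) ≡⟨ Finite.once fin a ⟩
      1                   ≡⟨ sym (𝟙-yes Q? (P⇒Q a pa)) ⟩
      𝟙 Q?                ∎
      where open ≤-Reasoning
    ... | inj₂ none = ≤-trans (≤-reflexive (count-none none)) z≤n

    count-exactly-one : ∀ a → P a → (∀ b → P b → b ≡ a) → count P? ≡ 1
    count-exactly-one a pa unique = trans
      (∑-cong (λ b → 𝟙-cong (P? b) (b ≟ a) (unique b) λ { refl → pa }))
      (Finite.once fin a)

    count≤card : count P? ≤ card A
    count≤card = ∑-mono (λ a → 𝟙≤1 (P? a))

module _ {A B : Set} {{_ : Finite A}} {{finB : Finite B}} where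

  -- For fixed `a` the indicators of `b ≡ φ a` sum to 1, so they can be inserted and the sums
  -- exchanged. Bijective reindexing and counting along injections both reduce to this.
  ∑-fibres : ∀ (φ : A → B) (f : A → ℕ) →
    ∑ f ≡ ∑ (λ b → ∑ (λ a → 𝟙 (b ≟ φ a) * f a))
  ∑-fibres φ f = trans
    (∑-cong (λ a → sym (∑-δ (λ _ → f a) (φ a))))
    (∑-swap (λ a b → 𝟙 (b ≟ φ a) * f a))

  ∑-reindex : ∀ (φ : A → B) (ψ : B → A) → (∀ b → φ (ψ b) ≡ b) → (∀ a → ψ (φ a) ≡ a) →
    ∀ (f : B → ℕ) → ∑ (λ a → f (φ a)) ≡ ∑ f
  ∑-reindex φ ψ φψ ψφ f = begin
    ∑ (λ a → f (φ a))                            ≡⟨ ∑-fibres φ (λ a → f (φ a)) ⟩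
    ∑ (λ b → ∑ (λ a → 𝟙 (b ≟ φ a) * f (φ a)))    ≡⟨ ∑-cong (λ b → ∑-cong (λ a →
                                                     cong (_* f (φ a)) (flip b a))) ⟩
    ∑ (λ b → ∑ (λ a → 𝟙 (a ≟ ψ b) * f (φ a)))    ≡⟨ ∑-cong (λ b → ∑-δ (λ a → f (φ a)) (ψ b)) ⟩
    ∑ (λ b → f (φ (ψ b)))                        ≡⟨ ∑-cong (λ b → cong f (φψ b)) ⟩
    ∑ f                                          ∎
    where
    open ≡-Reasoning
    flip : ∀ b a → 𝟙 (b ≟ φ a) ≡ 𝟙 (a ≟ ψ b)
    flip b a = 𝟙-cong (b ≟ φ a) (a ≟ ψ b)
      (λ eq → trans (sym (ψφ a)) (cong ψ (sym eq)))
      (λ eq → trans (sym (φψ b)) (cong φ (sym eq)))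

  count-injective : {P : A → Set} {Q : B → Set} (P? : ∀ a → Dec (P a)) (Q? : ∀ b → Dec (Q b)) →
    (φ : A → B) → (∀ a → P a → Q (φ a)) →
    (∀ a a′ → P a → P a′ → φ a ≡ φ a′ → a ≡ a′) → count P? ≤ count Q?
  count-injective {P} {Q} P? Q? φ P⇒Q injective = begin
    count P?                                     ≡⟨ ∑-fibres φ (λ a → 𝟙 (P? a)) ⟩
    ∑ (λ b → ∑ (λ a → 𝟙 (b ≟ φ a) * 𝟙 (P? a)))   ≡⟨ ∑-cong (λ b → ∑-cong (λ a →
                                                     sym (𝟙-× (b ≟ φ a) (P? a)))) ⟩
    ∑ (λ b → count (λ a → (b ≟ φ a) ×-dec P? a)) ≤⟨ ∑-mono (λ b →
                                                     count-unique (λ a → (b ≟ φ a) ×-dec P? a) (Q? b)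
                                                       (λ a (b≡φa , pa) → subst Q (sym b≡φa) (P⇒Q a pa))
                                                       (λ a a′ (b≡φa , pa) (b≡φa′ , pa′) →
                                                         injective a a′ pa pa′ (trans (sym b≡φa) b≡φa′))) ⟩
    count Q?                                     ∎
    where open ≤-Reasoning

  count≤card-injective : {P : A → Set} (P? : ∀ a → Dec (P a)) (φ : A → B) →
    (∀ a a′ → P a → P a′ → φ a ≡ φ a′ → a ≡ a′) → count P? ≤ card B
  count≤card-injective P? φ = count-injective P? (λ _ → yes tt) φ (λ _ _ → tt)

  card≤count-injective : {Q : B → Set} (Q? : ∀ b → Dec (Q b)) (φ : A → B) →
    (∀ a → Q (φ a)) → (∀ a a′ → φ a ≡ φ a′ → a ≡ a′) → card A ≤ count Q?
  card≤count-injective Q? φ Q-φ injective =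
    count-injective (λ _ → yes tt) Q? φ (λ a _ → Q-φ a) (λ a a′ _ _ → injective a a′)

-- Finite products, index sets and vectors

abstract
  instance
    finite-× : {A B : Set} {{_ : Finite A}} {{_ : Finite B}} → Finite (A × B)
    finite-× {A} {B} {{finA}} {{finB}} = record
      { _≟_      = ≡-dec _≟_ _≟_
      ; elements = pairs (Finite.elements finA) (Finite.elements finB)
      ; once     = λ (a , b) → begin
          ∑ᴸ (pairs (Finite.elements finA) (Finite.elements finB)) (λ z → 𝟙 (≡-dec _≟_ _≟_ z (a , b)))
            ≡⟨ ∑ᴸ-pairs (Finite.elements finA) (Finite.elements finB) _ ⟩
          ∑ (λ x → ∑ (λ y → 𝟙 (≡-dec _≟_ _≟_ (x , y) (a , b))))
            ≡⟨ ∑-cong (λ x → ∑-cong (λ y → split x y a b)) ⟩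
          ∑ (λ x → ∑ (λ y → 𝟙 (x ≟ a) * 𝟙 (y ≟ b)))
            ≡⟨ ∑-cong (λ x → ∑-*ˡ (𝟙 (x ≟ a)) (λ y → 𝟙 (y ≟ b))) ⟩
          ∑ (λ x → 𝟙 (x ≟ a) * ∑ (λ y → 𝟙 (y ≟ b)))
            ≡⟨ ∑-δ (λ _ → ∑ (λ y → 𝟙 (y ≟ b))) a ⟩
          ∑ (λ y → 𝟙 (y ≟ b))
            ≡⟨ Finite.once finB b ⟩
          1 ∎
      }
      where
      open ≡-Reasoning
      split : ∀ (x : A) (y : B) a b →
        𝟙 (≡-dec _≟_ _≟_ (x , y) (a , b)) ≡ 𝟙 (x ≟ a) * 𝟙 (y ≟ b)
      split x y a b = trans
        (𝟙-cong (≡-dec _≟_ _≟_ (x , y) (a , b)) ((x ≟ a) ×-dec (y ≟ b))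
          (λ { refl → refl , refl }) (λ { (refl , refl) → refl }))
        (𝟙-× (x ≟ a) (y ≟ b))

  -- It belongs in the abstract block because it depends on the list chosen for the product;
  -- elsewhere that list stays opaque.
  ∑-× : {A B : Set} {{_ : Finite A}} {{_ : Finite B}} (f : A × B → ℕ) →
    ∑ f ≡ ∑ (λ x → ∑ (λ y → f (x , y)))
  ∑-× {{finA}} {{finB}} = ∑ᴸ-pairs (Finite.elements finA) (Finite.elements finB)

card-× : (A B : Set) {{_ : Finite A}} {{_ : Finite B}} → card (A × B) ≡ card A * card B
card-× A B = trans (∑-× {A} {B} (λ _ → 1)) (∑-const {A} (card B))

abstract
  finite-↔ : {A B : Set} {{_ : Finite A}} (to : A → B) (from : B → A) →
    (∀ b → to (from b) ≡ b) → (∀ a → from (to a) ≡ a) → Finite B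
  finite-↔ {A} {B} {{finA}} to from to-from from-to = record
    { _≟_      = _≟′_
    ; elements = map to (Finite.elements finA)
    ; once     = λ b → begin
        ∑ᴸ (map to (Finite.elements finA)) (λ x → 𝟙 (x ≟′ b)) ≡⟨ ∑ᴸ-map to (Finite.elements finA) _ ⟩
        ∑ (λ a → 𝟙 (to a ≟′ b))                               ≡⟨ ∑-cong (λ a → 𝟙-cong (to a ≟′ b) (a ≟ from b)
                                                                  (λ { refl → sym (from-to a) })
                                                                  (λ { refl → to-from b })) ⟩
        ∑ (λ a → 𝟙 (a ≟ from b))                              ≡⟨ Finite.once finA (from b) ⟩
        1                                                     ∎
    }
    where
    open ≡-Reasoning
    _≟′_ : (x y : B) → Dec (x ≡ y)
    x ≟′ y with from x ≟ from y
    ... | yes eq = yes (trans (sym (to-from x)) (trans (cong to eq) (to-from y)))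
    ... | no neq = no λ { refl → neq refl }

card-↔ : {A B : Set} {{_ : Finite A}} {{_ : Finite B}} (to : A → B) (from : B → A) →
  (∀ b → to (from b) ≡ b) → (∀ a → from (to a) ≡ a) → card B ≡ card A
card-↔ to from to-from from-to = sym (∑-reindex to from to-from from-to (λ _ → 1))

allFinᴸ : ∀ n → List (Fin n)
allFinᴸ zero    = []
allFinᴸ (suc n) = zero ∷ map suc (allFinᴸ n)

abstract
  instance
    finite-Fin : ∀ {n} → Finite (Fin n)
    finite-Fin {n} = record { _≟_ = Fin._≟_ ; elements = allFinᴸ n ; once = once n }
      where
      once : ∀ n (i : Fin n) → ∑ᴸ (allFinᴸ n) (λ j → 𝟙 (j Fin.≟ i)) ≡ 1
      once (suc n) zero    = cong suc (trans
        (∑ᴸ-map suc (allFinᴸ n) (λ j → 𝟙 (j Fin.≟ zero))) (∑ᴸ-zero (allFinᴸ n)))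
      once (suc n) (suc i) = trans (∑ᴸ-map suc (allFinᴸ n) (λ j → 𝟙 (j Fin.≟ suc i)))
        (trans (∑ᴸ-cong (allFinᴸ n) (λ j →
          𝟙-cong (suc j Fin.≟ suc i) (j Fin.≟ i) Fin.suc-injective (cong suc)))
          (once n i))

  ∑-Fin-zero : ∀ (f : Fin 0 → ℕ) → ∑ f ≡ 0
  ∑-Fin-zero f = refl

  ∑-Fin-suc : ∀ {n} (f : Fin (suc n) → ℕ) → ∑ f ≡ f zero + ∑ (f ∘ suc)
  ∑-Fin-suc {n} f = cong (f zero +_) (∑ᴸ-map suc (allFinᴸ n) f)

card-Fin : ∀ n → card (Fin n) ≡ n
card-Fin zero    = ∑-Fin-zero _
card-Fin (suc n) = trans (∑-Fin-suc _) (cong suc (card-Fin n))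

abstract
  instance
    finite-Vec : {A : Set} {{_ : Finite A}} → ∀ {n} → Finite (Vec A n)
    finite-Vec {n = zero}  = record
      { _≟_ = λ { [] [] → yes refl } ; elements = [ [] ] ; once = λ { [] → refl } }
    finite-Vec {{finA}} {n = suc n} = finite-↔ {{finite-× {{finA}} {{finite-Vec}}}}
      (λ (x , xs) → x ∷ xs) (λ { (x ∷ xs) → x , xs }) (λ { (x ∷ xs) → refl }) (λ _ → refl)

  card-Vec-zero : (A : Set) {{_ : Finite A}} → card (Vec A 0) ≡ 1
  card-Vec-zero A = refl

∑-∷ : {A : Set} {{_ : Finite A}} → ∀ {n} (f : Vec A (suc n) → ℕ) →
  ∑ f ≡ ∑ (λ x → ∑ (λ xs → f (x ∷ xs)))
∑-∷ {A} {n} f = trans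
  (sym (∑-reindex {A × Vec A n} (λ (x , xs) → x ∷ xs) (λ { (x ∷ xs) → x , xs })
    (λ { (x ∷ xs) → refl }) (λ _ → refl) f))
  (∑-× {A} {Vec A n} _)

card-Vec : (A : Set) {{_ : Finite A}} → ∀ n → card (Vec A n) ≡ card A ^ n
card-Vec A zero    = card-Vec-zero A
card-Vec A (suc n) = begin
  card (Vec A (suc n))               ≡⟨ ∑-∷ {A} {n} (λ _ → 1) ⟩
  ∑ {A} (λ _ → card (Vec A n))       ≡⟨ ∑-const {A} (card (Vec A n)) ⟩
  card A * card (Vec A n)            ≡⟨ cong (card A *_) (card-Vec A n) ⟩
  card A * card A ^ n                ∎
  where open ≡-Reasoning

-- Linear algebra over a finite field

module LinearAlgebra (F : FiniteField) where
  open FiniteField F renaming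
    (Carrier to K; _+_ to _⊕_; _*_ to _⊗_; -_ to ⊖_; size to q)
  open Code F public

  ring : CommutativeRing _ _
  ring = record { isCommutativeRing = isCommutativeRing }

  open CommutativeRing ring public
    using ()
    renaming (+-identityˡ to ⊕-identityˡ; +-identityʳ to ⊕-identityʳ;
              *-identityˡ to ⊗-identityˡ; *-identityʳ to ⊗-identityʳ;
              zeroˡ to ⊗-zeroˡ; zeroʳ to ⊗-zeroʳ;
              distribˡ to ⊗-distribˡ-⊕; distribʳ to ⊗-distribʳ-⊕;
              +-assoc to ⊕-assoc; +-comm to ⊕-comm; *-assoc to ⊗-assoc; *-comm to ⊗-comm;
              -‿inverseˡ to ⊖-inverseˡ; -‿inverseʳ to ⊖-inverseʳ)
  open Algebra.Properties.Ring (CommutativeRing.ring ring) public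
    using () renaming (+-cancelˡ to ⊕-cancelˡ; +-cancelʳ to ⊕-cancelʳ)
  module Solver = Algebra.Solver.Ring.NaturalCoefficients.Default
    (CommutativeRing.commutativeSemiring ring)
  open Solver using (solve; _:=_; _:+_; _:*_)

  instance
    finite-K : Finite K
    finite-K = finite-↔ (Inverse.from enum) (Inverse.to enum)
      (Inverse.strictlyInverseʳ enum) (Inverse.strictlyInverseˡ enum)

  card-K : card K ≡ q
  card-K = trans
    (card-↔ (Inverse.from enum) (Inverse.to enum)
      (Inverse.strictlyInverseʳ enum) (Inverse.strictlyInverseˡ enum))
    (card-Fin q)

  q≡2+ : ∃ λ k → q ≡ suc (suc k)
  q≡2+ = distinct q (Inverse.to enum 0F) (Inverse.to enum 1F) λ eq →
    0≢1 (trans (sym (Inverse.strictlyInverseʳ enum 0F))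
        (trans (cong (Inverse.from enum) eq) (Inverse.strictlyInverseʳ enum 1F)))
    where
    distinct : ∀ n (x y : Fin n) → x ≢ y → ∃ λ k → n ≡ suc (suc k)
    distinct (suc zero)    zero zero x≢y = contradiction refl x≢y
    distinct (suc (suc k)) _    _    _   = k , refl

  -- This is q - 1. Being a visible successor, it is nonzero by computation and can be cancelled
  -- directly.
  p : ℕ
  p = suc (proj₁ q≡2+)

  q≡1+p : q ≡ suc p
  q≡1+p = proj₂ q≡2+

  card-Kⁿ : ∀ n → card (Vec K n) ≡ q ^ n
  card-Kⁿ n = trans (card-Vec K n) (cong (_^ n) card-K)

  ⊗-cancelʳ : ∀ {a b} c → c ≢ 0F → a ⊗ c ≡ b ⊗ c → a ≡ b
  ⊗-cancelʳ {a} {b} c c≢0 eq with inverse c c≢0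
  ... | d , cd≡1 = begin
    a           ≡⟨ sym (⊗-identityʳ a) ⟩
    a ⊗ 1F      ≡⟨ cong (a ⊗_) (sym cd≡1) ⟩
    a ⊗ (c ⊗ d) ≡⟨ sym (⊗-assoc a c d) ⟩
    a ⊗ c ⊗ d   ≡⟨ cong (_⊗ d) eq ⟩
    b ⊗ c ⊗ d   ≡⟨ ⊗-assoc b c d ⟩
    b ⊗ (c ⊗ d) ≡⟨ cong (b ⊗_) cd≡1 ⟩
    b ⊗ 1F      ≡⟨ ⊗-identityʳ b ⟩
    b           ∎
    where open ≡-Reasoning

  ⊗-cancelˡ : ∀ {a b} c → c ≢ 0F → c ⊗ a ≡ c ⊗ b → a ≡ b
  ⊗-cancelˡ {a} {b} c c≢0 eq =
    ⊗-cancelʳ c c≢0 (trans (⊗-comm a c) (trans eq (⊗-comm c b)))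

  ⊗-≢0 : ∀ {a b} → a ≢ 0F → b ≢ 0F → a ⊗ b ≢ 0F
  ⊗-≢0 {a} {b} a≢0 b≢0 ab≡0 = a≢0 (⊗-cancelʳ b b≢0 (trans ab≡0 (sym (⊗-zeroˡ b))))

  ≢0-⊗ˡ : ∀ {a b} → a ⊗ b ≢ 0F → a ≢ 0F
  ≢0-⊗ˡ {b = b} ab≢0 refl = ab≢0 (⊗-zeroˡ b)

  ≢0-⊗ʳ : ∀ {a b} → a ⊗ b ≢ 0F → b ≢ 0F
  ≢0-⊗ʳ {a} ab≢0 refl = ab≢0 (⊗-zeroʳ a)

  equalizer⇒0 : ∀ {a b} c → a ≢ b → c ⊗ a ≡ c ⊗ b → c ≡ 0F
  equalizer⇒0 c a≢b eq with c ≟ 0F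
  ... | yes c≡0 = c≡0
  ... | no c≢0  = contradiction (⊗-cancelˡ c c≢0 eq) a≢b

  ⊖-⊕ : ∀ a b → a ⊕ ⊖ b ⊕ b ≡ a
  ⊖-⊕ a b = trans (⊕-assoc a (⊖ b) b) (trans (cong (a ⊕_) (⊖-inverseˡ b)) (⊕-identityʳ a))

  ⊕-⊖ : ∀ a b → a ⊕ b ⊕ ⊖ b ≡ a
  ⊕-⊖ a b = trans (⊕-assoc a b (⊖ b)) (trans (cong (a ⊕_) (⊖-inverseʳ b)) (⊕-identityʳ a))

  -- The hypothesis is (a - b)(P - Q) = 0 with the negative terms moved across, since `Solver`
  -- treats identities of commutative semirings. The difference `s` is introduced through
  -- `s ⊕ b ≡ a`.
  crossed⇒≡ : ∀ {P Q} a b → P ≢ Q → a ⊗ P ⊕ b ⊗ Q ≡ b ⊗ P ⊕ a ⊗ Q → a ≡ b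
  crossed⇒≡ {P} {Q} a b P≢Q eq = begin
    a      ≡⟨ sym a≡s+b ⟩
    s ⊕ b  ≡⟨ cong (_⊕ b) (equalizer⇒0 s P≢Q sP≡sQ) ⟩
    0F ⊕ b ≡⟨ ⊕-identityˡ b ⟩
    b      ∎
    where
    open ≡-Reasoning
    s = a ⊕ ⊖ b
    a≡s+b : s ⊕ b ≡ a
    a≡s+b = ⊖-⊕ a b
    sP≡sQ : s ⊗ P ≡ s ⊗ Q
    sP≡sQ = ⊕-cancelʳ (b ⊗ P ⊕ b ⊗ Q) (s ⊗ P) (s ⊗ Q) (begin
      s ⊗ P ⊕ (b ⊗ P ⊕ b ⊗ Q)
        ≡⟨ solve 4 (λ s b P Q → s :* P :+ (b :* P :+ b :* Q) := (s :+ b) :* P :+ b :* Q) refl s b P Q ⟩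
      (s ⊕ b) ⊗ P ⊕ b ⊗ Q
        ≡⟨ cong (λ x → x ⊗ P ⊕ b ⊗ Q) a≡s+b ⟩
      a ⊗ P ⊕ b ⊗ Q
        ≡⟨ eq ⟩
      b ⊗ P ⊕ a ⊗ Q
        ≡⟨ cong (λ x → b ⊗ P ⊕ x ⊗ Q) (sym a≡s+b) ⟩
      b ⊗ P ⊕ (s ⊕ b) ⊗ Q
        ≡⟨ solve 4 (λ s b P Q → b :* P :+ (s :+ b) :* Q := s :* Q :+ (b :* P :+ b :* Q)) refl s b P Q ⟩
      s ⊗ Q ⊕ (b ⊗ P ⊕ b ⊗ Q) ∎)

  -- Multiplying the two equations by `w` and `z` gives them the same terms in `b` and `b′`.
  -- Eliminating these leaves (a - a′)(xw - yz) = 0. The second unknown follows by symmetry.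
  cramer : ∀ {a b a′ b′ x y z w} → x ⊗ w ≢ y ⊗ z →
    a ⊗ x ⊕ b ⊗ z ≡ a′ ⊗ x ⊕ b′ ⊗ z → a ⊗ y ⊕ b ⊗ w ≡ a′ ⊗ y ⊕ b′ ⊗ w → a ≡ a′ × b ≡ b′
  cramer det≢0 eq₁ eq₂ =
    first det≢0 eq₁ eq₂ ,
    first (λ zy≡wx → det≢0 (trans (⊗-comm _ _) (trans (sym zy≡wx) (⊗-comm _ _))))
      (trans (⊕-comm _ _) (trans eq₁ (⊕-comm _ _)))
      (trans (⊕-comm _ _) (trans eq₂ (⊕-comm _ _)))
    where
    -- The difference of two equations that share `β` on the left and `β′` on the right.
    exchange : ∀ {α β γ α′ β′ γ′} → α ⊕ β ≡ α′ ⊕ β′ → γ ⊕ β ≡ γ′ ⊕ β′ → α ⊕ γ′ ≡ α′ ⊕ γ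
    exchange {α} {β} {γ} {α′} {β′} {γ′} eq eq′ = ⊕-cancelʳ (β ⊕ β′) (α ⊕ γ′) (α′ ⊕ γ) (begin
      α ⊕ γ′ ⊕ (β ⊕ β′)
        ≡⟨ solve 4 (λ α β γ′ β′ → α :+ γ′ :+ (β :+ β′) := α :+ β :+ (γ′ :+ β′)) refl α β γ′ β′ ⟩
      α ⊕ β ⊕ (γ′ ⊕ β′)
        ≡⟨ cong₂ _⊕_ eq (sym eq′) ⟩
      α′ ⊕ β′ ⊕ (γ ⊕ β)
        ≡⟨ solve 4 (λ α′ β γ β′ → α′ :+ β′ :+ (γ :+ β) := α′ :+ γ :+ (β :+ β′)) refl α′ β γ β′ ⟩
      α′ ⊕ γ ⊕ (β ⊕ β′) ∎)
      where open ≡-Reasoning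
    expand₁ : ∀ a b x z w → (a ⊗ x ⊕ b ⊗ z) ⊗ w ≡ a ⊗ (x ⊗ w) ⊕ b ⊗ (z ⊗ w)
    expand₁ = solve 5 (λ a b x z w → (a :* x :+ b :* z) :* w := a :* (x :* w) :+ b :* (z :* w)) refl
    expand₂ : ∀ a b y w z → (a ⊗ y ⊕ b ⊗ w) ⊗ z ≡ a ⊗ (y ⊗ z) ⊕ b ⊗ (z ⊗ w)
    expand₂ = solve 5 (λ a b y w z → (a :* y :+ b :* w) :* z := a :* (y :* z) :+ b :* (z :* w)) refl
    first : ∀ {a b a′ b′ x y z w} → x ⊗ w ≢ y ⊗ z →
      a ⊗ x ⊕ b ⊗ z ≡ a′ ⊗ x ⊕ b′ ⊗ z → a ⊗ y ⊕ b ⊗ w ≡ a′ ⊗ y ⊕ b′ ⊗ w → a ≡ a′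
    first {a} {b} {a′} {b′} {x} {y} {z} {w} det≢0 eq₁ eq₂ = crossed⇒≡ a a′ det≢0 (exchange
      (trans (sym (expand₁ a b x z w)) (trans (cong (_⊗ w) eq₁) (expand₁ a′ b′ x z w)))
      (trans (sym (expand₂ a b y w z)) (trans (cong (_⊗ z) eq₂) (expand₂ a′ b′ y w z))))

  sumF-cong : ∀ {n} {f g : Fin n → K} → (∀ i → f i ≡ g i) → sumF f ≡ sumF g
  sumF-cong {zero}  f≡g = refl
  sumF-cong {suc n} f≡g = cong₂ _⊕_ (f≡g zero) (sumF-cong (λ i → f≡g (suc i)))

  sumF-0 : ∀ n → sumF {n} (λ _ → 0F) ≡ 0F
  sumF-0 zero    = refl
  sumF-0 (suc n) = trans (⊕-identityˡ _) (sumF-0 n)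

  sumF-⊕ : ∀ {n} (f g : Fin n → K) → sumF (λ i → f i ⊕ g i) ≡ sumF f ⊕ sumF g
  sumF-⊕ {zero}  f g = sym (⊕-identityˡ 0F)
  sumF-⊕ {suc n} f g = trans (cong (f zero ⊕ g zero ⊕_) (sumF-⊕ (f ∘ suc) (g ∘ suc)))
    (solve 4 (λ a b c d → a :+ b :+ (c :+ d) := a :+ c :+ (b :+ d)) refl
      (f zero) (g zero) (sumF (f ∘ suc)) (sumF (g ∘ suc)))

  sumF-⊗ : ∀ {n} c (f : Fin n → K) → sumF (λ i → c ⊗ f i) ≡ c ⊗ sumF f
  sumF-⊗ {zero}  c f = sym (⊗-zeroʳ c)
  sumF-⊗ {suc n} c f = trans (cong (c ⊗ f zero ⊕_) (sumF-⊗ c (f ∘ suc)))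
    (sym (⊗-distribˡ-⊕ c (f zero) (sumF (f ∘ suc))))

  sumF-swap : ∀ {n k} (f : Fin n → Fin k → K) →
    sumF (λ i → sumF (f i)) ≡ sumF (λ j → sumF (λ i → f i j))
  sumF-swap {zero}  {k} f = sym (sumF-0 k)
  sumF-swap {suc n} f = trans (cong (sumF (f zero) ⊕_) (sumF-swap (f ∘ suc)))
    (sym (sumF-⊕ (f zero) (λ j → sumF (λ i → f (suc i) j))))

  infixl 6 _+ᵛ_ _-ᵛ_
  infixl 7 _*ᵛ_

  _+ᵛ_ _-ᵛ_ : ∀ {n} → Vec K n → Vec K n → Vec K n
  _+ᵛ_ = zipWith _⊕_
  _-ᵛ_ = zipWith (λ a b → a ⊕ ⊖ b)

  _*ᵛ_ : ∀ {n} → K → Vec K n → Vec K n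
  c *ᵛ v = Vec.map (c ⊗_) v

  0ᵛ : ∀ {n} → Vec K n
  0ᵛ = replicate _ 0F

  -ᵛ-+ᵛ : ∀ {n} (u v : Vec K n) → u -ᵛ v +ᵛ v ≡ u
  -ᵛ-+ᵛ []      []      = refl
  -ᵛ-+ᵛ (a ∷ u) (b ∷ v) = cong₂ _∷_ (⊖-⊕ a b) (-ᵛ-+ᵛ u v)

  +ᵛ--ᵛ : ∀ {n} (u v : Vec K n) → u +ᵛ v -ᵛ v ≡ u
  +ᵛ--ᵛ []      []      = refl
  +ᵛ--ᵛ (a ∷ u) (b ∷ v) = cong₂ _∷_ (⊕-⊖ a b) (+ᵛ--ᵛ u v)

  0ᵛ-+ᵛ : ∀ {n} (v : Vec K n) → 0ᵛ +ᵛ v ≡ v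
  0ᵛ-+ᵛ []      = refl
  0ᵛ-+ᵛ (a ∷ v) = cong₂ _∷_ (⊕-identityˡ a) (0ᵛ-+ᵛ v)

  lookup-ext : ∀ {n} {u v : Vec K n} → (∀ i → lookup u i ≡ lookup v i) → u ≡ v
  lookup-ext {u = []}    {[]}    eq = refl
  lookup-ext {u = _ ∷ _} {_ ∷ _} eq = cong₂ _∷_ (eq zero) (lookup-ext (λ i → eq (suc i)))

  nonzero-entry : ∀ {n} (u : Vec K n) → u ≢ 0ᵛ → ∃ λ i → lookup u i ≢ 0F
  nonzero-entry u u≢0 = Fin.¬∀⟶∃¬ _ _ (λ i → lookup u i ≟ 0F)
    λ all-zero → u≢0 (lookup-ext λ i → trans (all-zero i) (sym (lookup-replicate i 0F)))

  bump : ∀ {n} → Fin n → K → Vec K n → Vec K n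
  bump zero    c (a ∷ v) = a ⊕ c ∷ v
  bump (suc i) c (a ∷ v) = a ∷ bump i c v

  bump-⊖ : ∀ {n} (i : Fin n) c v → bump i (⊖ c) (bump i c v) ≡ v
  bump-⊖ zero    c (a ∷ v) = cong (_∷ v) (⊕-⊖ a c)
  bump-⊖ (suc i) c (a ∷ v) = cong (a ∷_) (bump-⊖ i c v)

  bump-⊖′ : ∀ {n} (i : Fin n) c v → bump i c (bump i (⊖ c) v) ≡ v
  bump-⊖′ zero    c (a ∷ v) = cong (_∷ v) (⊖-⊕ a c)
  bump-⊖′ (suc i) c (a ∷ v) = cong (a ∷_) (bump-⊖′ i c v)

  bump-injective : ∀ {n} (i : Fin n) c {u v} → bump i c u ≡ bump i c v → u ≡ v
  bump-injective i c {u} {v} eq =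
    trans (sym (bump-⊖ i c u)) (trans (cong (bump i (⊖ c)) eq) (bump-⊖ i c v))

  dot : ∀ {n} → Vec K n → (Fin n → K) → K
  dot v a = sumF (λ i → lookup v i ⊗ a i)

  dot-cong : ∀ {n} (v : Vec K n) {a b} → (∀ i → a i ≡ b i) → dot v a ≡ dot v b
  dot-cong v a≡b = sumF-cong (λ i → cong (lookup v i ⊗_) (a≡b i))

  dot-zero : ∀ {n} (v : Vec K n) {a} → (∀ i → a i ≡ 0F) → dot v a ≡ 0F
  dot-zero {n} v a≡0 = trans
    (sumF-cong (λ i → trans (cong (lookup v i ⊗_) (a≡0 i)) (⊗-zeroʳ _))) (sumF-0 n)

  dot-+ᵛ : ∀ {n} (u v : Vec K n) a → dot (u +ᵛ v) a ≡ dot u a ⊕ dot v a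
  dot-+ᵛ u v a = trans
    (sumF-cong (λ i → trans (cong (_⊗ a i) (lookup-zipWith _⊕_ i u v)) (⊗-distribʳ-⊕ (a i) _ _)))
    (sumF-⊕ (λ i → lookup u i ⊗ a i) (λ i → lookup v i ⊗ a i))

  dot-*ᵛ : ∀ {n} c (v : Vec K n) a → dot (c *ᵛ v) a ≡ c ⊗ dot v a
  dot-*ᵛ c v a = trans
    (sumF-cong (λ i → trans (cong (_⊗ a i) (lookup-map i (c ⊗_) v)) (⊗-assoc c _ _)))
    (sumF-⊗ c (λ i → lookup v i ⊗ a i))

  dot-0ᵛ : ∀ {n} (a : Fin n → K) → dot 0ᵛ a ≡ 0F
  dot-0ᵛ {n} a = trans
    (sumF-cong (λ i → trans (cong (_⊗ a i) (lookup-replicate i 0F)) (⊗-zeroˡ _))) (sumF-0 n)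

  dot-bump : ∀ {n} (i : Fin n) c v a → dot (bump i c v) a ≡ dot v a ⊕ c ⊗ a i
  dot-bump zero    c (x ∷ v) a =
    solve 4 (λ x c y s → (x :+ c) :* y :+ s := x :* y :+ s :+ c :* y) refl x c (a zero) (dot v (a ∘ suc))
  dot-bump (suc i) c (x ∷ v) a =
    trans (cong (x ⊗ a zero ⊕_) (dot-bump i c v (a ∘ suc))) (sym (⊕-assoc _ _ _))

  dot-bump₂ : ∀ {n} (i i′ : Fin n) c c′ v a →
    dot (bump i c (bump i′ c′ v)) a ≡ dot v a ⊕ (c ⊗ a i ⊕ c′ ⊗ a i′)
  dot-bump₂ i i′ c c′ v a = begin
    dot (bump i c (bump i′ c′ v)) a      ≡⟨ dot-bump i c (bump i′ c′ v) a ⟩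
    dot (bump i′ c′ v) a ⊕ c ⊗ a i       ≡⟨ cong (_⊕ c ⊗ a i) (dot-bump i′ c′ v a) ⟩
    dot v a ⊕ c′ ⊗ a i′ ⊕ c ⊗ a i        ≡⟨ ⊕-assoc (dot v a) _ _ ⟩
    dot v a ⊕ (c′ ⊗ a i′ ⊕ c ⊗ a i)      ≡⟨ cong (dot v a ⊕_) (⊕-comm _ _) ⟩
    dot v a ⊕ (c ⊗ a i ⊕ c′ ⊗ a i′)      ∎
    where open ≡-Reasoning

  unit : ∀ {n} → Fin n → Vec K n
  unit zero    = 1F ∷ 0ᵛ
  unit (suc i) = 0F ∷ unit i

  dot-unit : ∀ {n} (i : Fin n) a → dot (unit i) a ≡ a i
  dot-unit zero    a = begin
    1F ⊗ a zero ⊕ dot 0ᵛ (a ∘ suc) ≡⟨ cong₂ _⊕_ (⊗-identityˡ (a zero)) (dot-0ᵛ (a ∘ suc)) ⟩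
    a zero ⊕ 0F                    ≡⟨ ⊕-identityʳ (a zero) ⟩
    a zero                         ∎
    where open ≡-Reasoning
  dot-unit (suc i) a = begin
    0F ⊗ a zero ⊕ dot (unit i) (a ∘ suc) ≡⟨ cong₂ _⊕_ (⊗-zeroˡ (a zero)) (dot-unit i (a ∘ suc)) ⟩
    0F ⊕ a (suc i)                       ≡⟨ ⊕-identityˡ (a (suc i)) ⟩
    a (suc i)                            ∎
    where open ≡-Reasoning

  lookup-unit : ∀ {n} (i : Fin n) → lookup (unit i) i ≡ 1F
  lookup-unit zero    = refl
  lookup-unit (suc i) = lookup-unit i

  dot-swap : ∀ {n k} (u : Vec K n) (v : Vec K k) (M : Fin n → Fin k → K) →
    dot u (λ i → dot v (M i)) ≡ dot v (λ j → dot u (λ i → M i j))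
  dot-swap u v M = begin
    sumF (λ i → lookup u i ⊗ sumF (λ j → lookup v j ⊗ M i j))
      ≡⟨ sumF-cong (λ i → sym (sumF-⊗ (lookup u i) (λ j → lookup v j ⊗ M i j))) ⟩
    sumF (λ i → sumF (λ j → lookup u i ⊗ (lookup v j ⊗ M i j)))
      ≡⟨ sumF-swap (λ i j → lookup u i ⊗ (lookup v j ⊗ M i j)) ⟩
    sumF (λ j → sumF (λ i → lookup u i ⊗ (lookup v j ⊗ M i j)))
      ≡⟨ sumF-cong (λ j → sumF-cong (λ i →
           solve 3 (λ x y z → x :* (y :* z) := y :* (x :* z)) refl (lookup u i) (lookup v j) (M i j))) ⟩
    sumF (λ j → sumF (λ i → lookup v j ⊗ (lookup u i ⊗ M i j)))
      ≡⟨ sumF-cong (λ j → sumF-⊗ (lookup v j) (λ i → lookup u i ⊗ M i j)) ⟩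
    sumF (λ j → lookup v j ⊗ sumF (λ i → lookup u i ⊗ M i j)) ∎
    where open ≡-Reasoning

  -- Translating the vectors by `c` in coordinate `i` permutes them, so each of the q values of `c`
  -- yields the same count. For a fixed vector exactly one `c` makes the product with `a` vanish,
  -- because `a i` is invertible.
  count-zeros : ∀ {n} (a : Fin n → K) i → a i ≢ 0F → q * count (λ v → dot v a ≟ 0F) ≡ q ^ n
  count-zeros {n} a i ai≢0 = begin
    q * count (λ v → dot v a ≟ 0F)
      ≡⟨ cong (_* count (λ v → dot v a ≟ 0F)) (sym card-K) ⟩
    card K * count (λ v → dot v a ≟ 0F)
      ≡⟨ sym (∑-const {K} _) ⟩
    ∑ {K} (λ c → ∑ (λ v → 𝟙 (dot v a ≟ 0F)))
      ≡⟨ ∑-cong (λ c → sym (∑-reindex (bump i c) (bump i (⊖ c)) (bump-⊖′ i c) (bump-⊖ i c)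
           (λ v → 𝟙 (dot v a ≟ 0F)))) ⟩
    ∑ {K} (λ c → ∑ {Vec K n} (λ v → 𝟙 (dot (bump i c v) a ≟ 0F)))
      ≡⟨ ∑-swap {K} {Vec K n} (λ c v → 𝟙 (dot (bump i c v) a ≟ 0F)) ⟩
    ∑ {Vec K n} (λ v → ∑ {K} (λ c → 𝟙 (dot (bump i c v) a ≟ 0F)))
      ≡⟨ ∑-cong one-shift ⟩
    card (Vec K n)
      ≡⟨ card-Kⁿ n ⟩
    q ^ n ∎
    where
    open ≡-Reasoning
    b = proj₁ (inverse (a i) ai≢0)
    one-shift : ∀ v → count (λ c → dot (bump i c v) a ≟ 0F) ≡ 1
    one-shift v = count-exactly-one (λ c → dot (bump i c v) a ≟ 0F) c₀ vanishes unique
      where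
      s  = dot v a
      c₀ = ⊖ s ⊗ b
      vanishes : dot (bump i c₀ v) a ≡ 0F
      vanishes = begin
        dot (bump i c₀ v) a   ≡⟨ dot-bump i c₀ v a ⟩
        s ⊕ ⊖ s ⊗ b ⊗ a i     ≡⟨ cong (s ⊕_) (⊗-assoc (⊖ s) b (a i)) ⟩
        s ⊕ ⊖ s ⊗ (b ⊗ a i)   ≡⟨ cong (λ x → s ⊕ ⊖ s ⊗ x) (trans (⊗-comm b (a i)) (proj₂ (inverse (a i) ai≢0))) ⟩
        s ⊕ ⊖ s ⊗ 1F          ≡⟨ cong (s ⊕_) (⊗-identityʳ (⊖ s)) ⟩
        s ⊕ ⊖ s               ≡⟨ ⊖-inverseʳ s ⟩
        0F                    ∎
      unique : ∀ c → dot (bump i c v) a ≡ 0F → c ≡ c₀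
      unique c eq = ⊗-cancelʳ (a i) ai≢0 (⊕-cancelˡ s (c ⊗ a i) (c₀ ⊗ a i) (begin
        s ⊕ c ⊗ a i          ≡⟨ sym (dot-bump i c v a) ⟩
        dot (bump i c v) a   ≡⟨ trans eq (sym vanishes) ⟩
        dot (bump i c₀ v) a  ≡⟨ dot-bump i c₀ v a ⟩
        s ⊕ c₀ ⊗ a i         ∎))

  count-nonzeros : ∀ {n} (a : Fin n → K) i → a i ≢ 0F →
    q * count (λ v → ¬? (dot v a ≟ 0F)) ≡ p * q ^ n
  count-nonzeros {n} a i ai≢0 = +-cancelˡ-≡ (q ^ n) _ _ (begin
    q ^ n + q * count (λ v → ¬? (dot v a ≟ 0F))
      ≡⟨ cong (_+ q * count (λ v → ¬? (dot v a ≟ 0F))) (sym (count-zeros a i ai≢0)) ⟩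
    q * count (λ v → dot v a ≟ 0F) + q * count (λ v → ¬? (dot v a ≟ 0F))
      ≡⟨ sym (*-distribˡ-+ q (count (λ v → dot v a ≟ 0F)) _) ⟩
    q * (count (λ v → dot v a ≟ 0F) + count (λ v → ¬? (dot v a ≟ 0F)))
      ≡⟨ cong (q *_) (trans (count-¬ (λ v → dot v a ≟ 0F)) (card-Kⁿ n)) ⟩
    q * q ^ n
      ≡⟨ cong (_* q ^ n) q≡1+p ⟩
    q ^ n + p * q ^ n ∎)
    where open ≡-Reasoning

  -- Matrices of rank at most one and left kernels

  RankAtMostOne : ∀ {ℓ m} → Mat ℓ m → Set
  RankAtMostOne M = ∀ i i′ j j′ → M i j ⊗ M i′ j′ ≡ M i j′ ⊗ M i′ j

  rankAtMostOne? : ∀ {ℓ m} (M : Mat ℓ m) → Dec (RankAtMostOne M)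
  rankAtMostOne? M = Fin.all? λ i → Fin.all? λ i′ → Fin.all? λ j → Fin.all? λ j′ →
    M i j ⊗ M i′ j′ ≟ M i j′ ⊗ M i′ j

  nonzero-minor : ∀ {ℓ m} (M : Mat ℓ m) → ¬ RankAtMostOne M →
    ∃ λ i → ∃ λ i′ → ∃ λ j → ∃ λ j′ → M i j ⊗ M i′ j′ ≢ M i j′ ⊗ M i′ j
  nonzero-minor M ¬rank≤1
    with i , ¬i ← Fin.¬∀⟶∃¬ _ _ (λ i → Fin.all? λ i′ → Fin.all? λ j → Fin.all? λ j′ →
                    M i j ⊗ M i′ j′ ≟ M i j′ ⊗ M i′ j) ¬rank≤1
    with i′ , ¬i′ ← Fin.¬∀⟶∃¬ _ _ (λ i′ → Fin.all? λ j → Fin.all? λ j′ →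
                    M i j ⊗ M i′ j′ ≟ M i j′ ⊗ M i′ j) ¬i
    with j , ¬j ← Fin.¬∀⟶∃¬ _ _ (λ j → Fin.all? λ j′ →
                    M i j ⊗ M i′ j′ ≟ M i j′ ⊗ M i′ j) ¬i′
    with j′ , ¬j′ ← Fin.¬∀⟶∃¬ _ _ (λ j′ →
                    M i j ⊗ M i′ j′ ≟ M i j′ ⊗ M i′ j) ¬j
    = i , i′ , j , j′ , ¬j′

  LeftKernel : ∀ {ℓ m} → Mat ℓ m → Vec K ℓ → Set
  LeftKernel M u = ∀ j → dot u (λ i → M i j) ≡ 0F

  leftKernel? : ∀ {ℓ m} (M : Mat ℓ m) u → Dec (LeftKernel M u)
  leftKernel? M u = Fin.all? λ j → dot u (λ i → M i j) ≟ 0F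

  leftKernel-nonzero : ∀ {ℓ m} (M : Mat ℓ m) i j → M i j ≢ 0F →
    q * count (leftKernel? M) ≤ q ^ ℓ
  leftKernel-nonzero {ℓ} M i j Mij≢0 = begin
    q * count (leftKernel? M)
      ≤⟨ *-monoʳ-≤ q (count-injective (leftKernel? M) (λ u → dot u (λ i → M i j) ≟ 0F)
           (λ u → u) (λ u ker → ker j) (λ _ _ _ _ eq → eq)) ⟩
    q * count (λ u → dot u (λ i → M i j) ≟ 0F)
      ≡⟨ count-zeros (λ i → M i j) i Mij≢0 ⟩
    q ^ ℓ ∎
    where open ≤-Reasoning

  -- The translates of the left kernel by `a` in coordinate `i` and `b` in coordinate `i′` are
  -- pairwise disjoint: multiplying a translate with columns `j` and `j′` removes the kernel vector,
  -- and `cramer` recovers `a` and `b`. So q² copies of the kernel fit into the whole space.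
  leftKernel-minor : ∀ {ℓ m} (M : Mat ℓ m) i i′ j j′ → M i j ⊗ M i′ j′ ≢ M i j′ ⊗ M i′ j →
    q * q * count (leftKernel? M) ≤ q ^ ℓ
  leftKernel-minor {ℓ} M i i′ j j′ minor≢0 = begin
    q * q * count (leftKernel? M)
      ≡⟨ cong (_* count (leftKernel? M)) (sym (trans (card-× K K) (cong₂ _*_ card-K card-K))) ⟩
    card (K × K) * count (leftKernel? M)
      ≡⟨ sym (∑-const {K × K} (count (leftKernel? M))) ⟩
    ∑ {K × K} (λ _ → count (leftKernel? M))
      ≡⟨ sym (∑-× {K × K} {Vec K ℓ} (λ (_ , u) → 𝟙 (leftKernel? M u))) ⟩
    count {(K × K) × Vec K ℓ} (λ (_ , u) → leftKernel? M u)
      ≤⟨ count≤card-injective (λ (_ , u) → leftKernel? M u) shift injective ⟩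
    card (Vec K ℓ)
      ≡⟨ card-Kⁿ ℓ ⟩
    q ^ ℓ ∎
    where
    open ≤-Reasoning
    shift : (K × K) × Vec K ℓ → Vec K ℓ
    shift ((a , b) , u) = bump i a (bump i′ b u)
    column : ∀ a b u → LeftKernel M u → ∀ k →
      dot (shift ((a , b) , u)) (λ i → M i k) ≡ a ⊗ M i k ⊕ b ⊗ M i′ k
    column a b u ker k = trans (dot-bump₂ i i′ a b u (λ i → M i k))
      (trans (cong (_⊕ (a ⊗ M i k ⊕ b ⊗ M i′ k)) (ker k)) (⊕-identityˡ _))
    injective : ∀ s t → LeftKernel M (proj₂ s) → LeftKernel M (proj₂ t) → shift s ≡ shift t → s ≡ t
    injective ((a , b) , u) ((a′ , b′) , u′) ker ker′ eq =
      conclude (cramer minor≢0 (same j) (same j′))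
      where
      same : ∀ k → a ⊗ M i k ⊕ b ⊗ M i′ k ≡ a′ ⊗ M i k ⊕ b′ ⊗ M i′ k
      same k = trans (sym (column a b u ker k))
        (trans (cong (λ v → dot v (λ i → M i k)) eq) (column a′ b′ u′ ker′ k))
      conclude : a ≡ a′ × b ≡ b′ → ((a , b) , u) ≡ ((a′ , b′) , u′)
      conclude (refl , refl) = cong ((a , b) ,_) (bump-injective i′ b (bump-injective i a eq))

  leftKernel-rank≥2 : ∀ {ℓ m} (M : Mat ℓ m) → ¬ RankAtMostOne M →
    q * q * count (leftKernel? M) ≤ q ^ ℓ
  leftKernel-rank≥2 M ¬rank≤1 =
    let i , i′ , j , j′ , minor≢0 = nonzero-minor M ¬rank≤1
    in leftKernel-minor M i i′ j j′ minor≢0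

-- Matrices of rank at most one in a subspace

module Subspaces (F : FiniteField) where
  open FiniteField F renaming
    (Carrier to K; _+_ to _⊕_; _*_ to _⊗_; -_ to ⊖_; size to q)
  open LinearAlgebra F
  open Solver using (solve; _:=_; _:+_; _:*_)

  -- The first nonzero entry, with value `0F` on the zero vector. This default makes `lead`
  -- homogeneous for all scalars, including zero; `columnFactor-columns∥` scales by matrix entries
  -- that may vanish.
  lead : ∀ {n} → (Fin n → K) → K
  lead {zero}  a = 0F
  lead {suc n} a with a zero ≟ 0F
  ... | yes _ = lead (a ∘ suc)
  ... | no _  = a zero

  lead-cong : ∀ {n} {a b : Fin n → K} → (∀ i → a i ≡ b i) → lead a ≡ lead b
  lead-cong {zero}                  a≡b = refl
  lead-cong {suc n} {a} {b} a≡b with a zero ≟ 0F | b zero ≟ 0F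
  ... | yes _  | yes _  = lead-cong (λ i → a≡b (suc i))
  ... | yes a0 | no b≢0 = contradiction (trans (sym (a≡b zero)) a0) b≢0
  ... | no a≢0 | yes b0 = contradiction (trans (a≡b zero) b0) a≢0
  ... | no _   | no _   = a≡b zero

  lead-zero : ∀ {n} {a : Fin n → K} → (∀ i → a i ≡ 0F) → lead a ≡ 0F
  lead-zero {zero}      a≡0 = refl
  lead-zero {suc n} {a} a≡0 with a zero ≟ 0F
  ... | yes _  = lead-zero (λ i → a≡0 (suc i))
  ... | no a≢0 = contradiction (a≡0 zero) a≢0

  lead≡0⇒zero : ∀ {n} {a : Fin n → K} → lead a ≡ 0F → ∀ i → a i ≡ 0F
  lead≡0⇒zero {suc n} {a} eq i with a zero ≟ 0F
  lead≡0⇒zero {suc n} {a} eq zero    | yes a0 = a0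
  lead≡0⇒zero {suc n} {a} eq (suc i) | yes _  = lead≡0⇒zero eq i
  lead≡0⇒zero {suc n} {a} eq i       | no a≢0 = contradiction eq a≢0

  lead-⊗ : ∀ {n} c (a : Fin n → K) → lead (λ i → c ⊗ a i) ≡ c ⊗ lead a
  lead-⊗ c a with c ≟ 0F
  ... | yes refl = trans (lead-zero (λ i → ⊗-zeroˡ (a i))) (sym (⊗-zeroˡ _))
  ... | no c≢0   = scale a
    where
    scale : ∀ {n} (a : Fin n → K) → lead (λ i → c ⊗ a i) ≡ c ⊗ lead a
    scale {zero}  a = sym (⊗-zeroʳ c)
    scale {suc n} a with a zero ≟ 0F | c ⊗ a zero ≟ 0F
    ... | yes _   | yes _   = scale (a ∘ suc)
    ... | yes a0  | no ca≢0 = contradiction (trans (cong (c ⊗_) a0) (⊗-zeroʳ c)) ca≢0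
    ... | no a≢0  | yes ca0 = contradiction ca0 (⊗-≢0 c≢0 a≢0)
    ... | no _    | no _    = refl

  instance
    q-nonZero : NonZero q
    q-nonZero = subst NonZero (sym q≡1+p) _

  -- (A − q²)(Y − A) ≥ 0.
  extremal : ∀ A N Y → q * q ≤ A → A ≤ Y → A * N + A * q ≤ A * A + q * Y * q → N + q ≤ Y + q * q
  extremal A N Y q²≤A A≤Y bound with t , refl ← m≤n⇒∃[o]m+o≡n A≤Y =
    *-cancelˡ-≤ A {{>-nonZero (≤-trans (>-nonZero⁻¹ (q * q) {{m*n≢0 q q}}) q²≤A)}} (begin
      A * (N + q)                        ≡⟨ *-distribˡ-+ A N q ⟩
      A * N + A * q                      ≤⟨ bound ⟩
      A * A + q * (A + t) * q            ≡⟨ rearrange A q t ⟩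
      A * A + q * q * A + q * q * t      ≤⟨ +-monoʳ-≤ (A * A + q * q * A) (*-monoˡ-≤ t q²≤A) ⟩
      A * A + q * q * A + A * t          ≡⟨ collect A q t ⟩
      A * (A + t + q * q)                ∎)
    where
    open ≤-Reasoning
    rearrange : ∀ A q t → A * A + q * (A + t) * q ≡ A * A + q * q * A + q * q * t
    rearrange = solve-∀
    collect : ∀ A q t → A * A + q * q * A + A * t ≡ A * (A + t + q * q)
    collect = solve-∀

  Parallel : ∀ {n} → Vec K n → Vec K n → Set
  Parallel x y = ∀ s t → lookup x s ⊗ lookup y t ≡ lookup x t ⊗ lookup y s

  parallel? : ∀ {n} (x y : Vec K n) → Dec (Parallel x y)
  parallel? x y = Fin.all? λ s → Fin.all? λ t → lookup x s ⊗ lookup y t ≟ lookup x t ⊗ lookup y s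

  nonzero-det : ∀ {n} (x y : Vec K n) → ¬ Parallel x y →
    ∃ λ s → ∃ λ t → lookup x s ⊗ lookup y t ≢ lookup x t ⊗ lookup y s
  nonzero-det x y ¬parallel =
    let s , ¬s = Fin.¬∀⟶∃¬ _ _ (λ s → Fin.all? λ t →
                   lookup x s ⊗ lookup y t ≟ lookup x t ⊗ lookup y s) ¬parallel
        t , ¬t = Fin.¬∀⟶∃¬ _ _ (λ t →
                   lookup x s ⊗ lookup y t ≟ lookup x t ⊗ lookup y s) ¬s
    in s , t , ¬t

  module _ {ℓ m r : ℕ} (fs : Fin r → Mat ℓ m) where

    -- The elements of D are counted through their coefficient vectors, which form a finite type
    -- with decidable equality; independence makes this parametrisation faithful.
    span : Vec K r → Mat ℓ m
    span x i j = dot x (λ t → fs t i j)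

    span-+ᵛ : ∀ x y i j → span (x +ᵛ y) i j ≡ span x i j ⊕ span y i j
    span-+ᵛ x y i j = dot-+ᵛ x y (λ t → fs t i j)

    span-*ᵛ : ∀ c x i j → span (c *ᵛ x) i j ≡ c ⊗ span x i j
    span-*ᵛ c x i j = dot-*ᵛ c x (λ t → fs t i j)

    -- The coefficient vectors x for which span x has the form u wᵀ (when u is nonzero).
    Columns∥ : Vec K ℓ → Vec K r → Set
    Columns∥ u x = ∀ i i′ j → span x i j ⊗ lookup u i′ ≡ span x i′ j ⊗ lookup u i

    columns∥? : ∀ u x → Dec (Columns∥ u x)
    columns∥? u x = Fin.all? λ i → Fin.all? λ i′ → Fin.all? λ j →
      span x i j ⊗ lookup u i′ ≟ span x i′ j ⊗ lookup u i

    ¬columns∥ : ∀ u x → ¬ Columns∥ u x →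
      ∃ λ i → ∃ λ i′ → ∃ λ j → span x i j ⊗ lookup u i′ ≢ span x i′ j ⊗ lookup u i
    ¬columns∥ u x ¬∥ =
      let i , ¬i = Fin.¬∀⟶∃¬ _ _ (λ i → Fin.all? λ i′ → Fin.all? λ j →
                     span x i j ⊗ lookup u i′ ≟ span x i′ j ⊗ lookup u i) ¬∥
          i′ , ¬i′ = Fin.¬∀⟶∃¬ _ _ (λ i′ → Fin.all? λ j →
                     span x i j ⊗ lookup u i′ ≟ span x i′ j ⊗ lookup u i) ¬i
          j , ¬j = Fin.¬∀⟶∃¬ _ _ (λ j →
                     span x i j ⊗ lookup u i′ ≟ span x i′ j ⊗ lookup u i) ¬i′
      in i , i′ , j , ¬j

    columns∥-combination : ∀ u x y a b → Columns∥ u x → Columns∥ u y → Columns∥ u (a *ᵛ x +ᵛ b *ᵛ y)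
    columns∥-combination u x y a b ∥x ∥y i i′ j = begin
      span (a *ᵛ x +ᵛ b *ᵛ y) i j ⊗ lookup u i′ ≡⟨ expand i i′ ⟩
      a ⊗ (span x i j ⊗ lookup u i′) ⊕ b ⊗ (span y i j ⊗ lookup u i′)
        ≡⟨ cong₂ (λ s t → a ⊗ s ⊕ b ⊗ t) (∥x i i′ j) (∥y i i′ j) ⟩
      a ⊗ (span x i′ j ⊗ lookup u i) ⊕ b ⊗ (span y i′ j ⊗ lookup u i)
        ≡⟨ sym (expand i′ i) ⟩
      span (a *ᵛ x +ᵛ b *ᵛ y) i′ j ⊗ lookup u i ∎
      where
      open ≡-Reasoning
      expand : ∀ i i′ → span (a *ᵛ x +ᵛ b *ᵛ y) i j ⊗ lookup u i′ ≡
        a ⊗ (span x i j ⊗ lookup u i′) ⊕ b ⊗ (span y i j ⊗ lookup u i′)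
      expand i i′ = trans
        (cong (_⊗ lookup u i′) (trans (span-+ᵛ (a *ᵛ x) (b *ᵛ y) i j)
          (cong₂ _⊕_ (span-*ᵛ a x i j) (span-*ᵛ b y i j))))
        (solve 5 (λ a b x y u → (a :* x :+ b :* y) :* u := a :* (x :* u) :+ b :* (y :* u)) refl
          a b (span x i j) (span y i j) (lookup u i′))

    columns∥-difference : ∀ u x y → Columns∥ u x → Columns∥ u y → Columns∥ u (x -ᵛ y)
    columns∥-difference u x y ∥x ∥y i i′ j = ⊕-cancelʳ (span y i j ⊗ lookup u i′) _ _ (begin
      span (x -ᵛ y) i j ⊗ lookup u i′ ⊕ span y i j ⊗ lookup u i′ ≡⟨ restore i i′ ⟩
      span x i j ⊗ lookup u i′                                  ≡⟨ ∥x i i′ j ⟩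
      span x i′ j ⊗ lookup u i                                  ≡⟨ sym (restore i′ i) ⟩
      span (x -ᵛ y) i′ j ⊗ lookup u i ⊕ span y i′ j ⊗ lookup u i ≡⟨ cong (span (x -ᵛ y) i′ j ⊗ lookup u i ⊕_) (sym (∥y i i′ j)) ⟩
      span (x -ᵛ y) i′ j ⊗ lookup u i ⊕ span y i j ⊗ lookup u i′ ∎)
      where
      open ≡-Reasoning
      restore : ∀ i i′ → span (x -ᵛ y) i j ⊗ lookup u i′ ⊕ span y i j ⊗ lookup u i′ ≡
        span x i j ⊗ lookup u i′
      restore i i′ = begin
        span (x -ᵛ y) i j ⊗ lookup u i′ ⊕ span y i j ⊗ lookup u i′ ≡⟨ sym (⊗-distribʳ-⊕ (lookup u i′) _ _) ⟩
        (span (x -ᵛ y) i j ⊕ span y i j) ⊗ lookup u i′            ≡⟨ cong (_⊗ lookup u i′) (sym (span-+ᵛ (x -ᵛ y) y i j)) ⟩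
        span (x -ᵛ y +ᵛ y) i j ⊗ lookup u i′                      ≡⟨ cong (λ z → span z i j ⊗ lookup u i′) (-ᵛ-+ᵛ x y) ⟩
        span x i j ⊗ lookup u i′                                  ∎

    -- Read contrapositively: if `x` fails to be parallel to `u` at one particular place, every
    -- element of its coset modulo D_u fails at the same place.
    columns∥-+ᵛ⁻ : ∀ u x h i i′ j → Columns∥ u h →
      span (x +ᵛ h) i j ⊗ lookup u i′ ≡ span (x +ᵛ h) i′ j ⊗ lookup u i →
      span x i j ⊗ lookup u i′ ≡ span x i′ j ⊗ lookup u i
    columns∥-+ᵛ⁻ u x h i i′ j ∥h eq = ⊕-cancelʳ (span h i j ⊗ lookup u i′) _ _ (begin
      span x i j ⊗ lookup u i′ ⊕ span h i j ⊗ lookup u i′  ≡⟨ sym (expand i i′) ⟩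
      span (x +ᵛ h) i j ⊗ lookup u i′                      ≡⟨ eq ⟩
      span (x +ᵛ h) i′ j ⊗ lookup u i                      ≡⟨ expand i′ i ⟩
      span x i′ j ⊗ lookup u i ⊕ span h i′ j ⊗ lookup u i  ≡⟨ cong (span x i′ j ⊗ lookup u i ⊕_) (sym (∥h i i′ j)) ⟩
      span x i′ j ⊗ lookup u i ⊕ span h i j ⊗ lookup u i′  ∎)
      where
      open ≡-Reasoning
      expand : ∀ i i′ → span (x +ᵛ h) i j ⊗ lookup u i′ ≡
        span x i j ⊗ lookup u i′ ⊕ span h i j ⊗ lookup u i′
      expand i i′ = trans (cong (_⊗ lookup u i′) (span-+ᵛ x h i j)) (⊗-distribʳ-⊕ (lookup u i′) _ _)

    module _ (independent : ∀ x → (∀ i j → span x i j ≡ 0F) → x ≡ 0ᵛ) where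

      span-injective : ∀ x y → (∀ i j → span x i j ≡ span y i j) → x ≡ y
      span-injective x y eq = begin
        x            ≡⟨ sym (-ᵛ-+ᵛ x y) ⟩
        x -ᵛ y +ᵛ y  ≡⟨ cong (_+ᵛ y) (independent (x -ᵛ y) difference) ⟩
        0ᵛ +ᵛ y      ≡⟨ 0ᵛ-+ᵛ y ⟩
        y            ∎
        where
        open ≡-Reasoning
        difference : ∀ i j → span (x -ᵛ y) i j ≡ 0F
        difference i j = ⊕-cancelʳ (span y i j) _ _ (begin
          span (x -ᵛ y) i j ⊕ span y i j ≡⟨ sym (span-+ᵛ (x -ᵛ y) y i j) ⟩
          span (x -ᵛ y +ᵛ y) i j         ≡⟨ cong (λ z → span z i j) (-ᵛ-+ᵛ x y) ⟩
          span x i j                     ≡⟨ eq i j ⟩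
          span y i j                     ≡⟨ sym (⊕-identityˡ _) ⟩
          0F ⊕ span y i j                ∎)

      module _ (u : Vec K ℓ) (i₀ : Fin ℓ) (u≢0 : lookup u i₀ ≢ 0F) where

        -- Row `i₀` of u wᵀ is a nonzero multiple of wᵀ and so determines the matrix. Hence D_u has
        -- dimension at most m.
        columns∥-injective : ∀ x y → Columns∥ u x → Columns∥ u y →
          (∀ j → span x i₀ j ≡ span y i₀ j) → x ≡ y
        columns∥-injective x y ∥x ∥y eq = span-injective x y λ i j →
          ⊗-cancelʳ (lookup u i₀) u≢0
            (trans (∥x i i₀ j) (trans (cong (_⊗ lookup u i) (eq j)) (sym (∥y i i₀ j))))

        count-columns∥-≤ : count (columns∥? u) ≤ q ^ m
        count-columns∥-≤ = ≤-trans
          (count≤card-injective (columns∥? u) (λ x → tabulate (span x i₀)) λ x y ∥x ∥y eq →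
            columns∥-injective x y ∥x ∥y λ j →
              trans (sym (lookup∘tabulate (span x i₀) j))
                (trans (cong (λ v → lookup v j) eq) (lookup∘tabulate (span y i₀) j)))
          (≤-reflexive (card-Kⁿ m))

        -- Let `g` be the difference of the shifts, of the form u wᵀ. Equal entries at `(i₀, j)`
        -- make column `j` of `g` zero, so `Y` and `Y` + `g` share column `j`. The minors through
        -- that column show that, in rows `i` and `i′`, every column of `g` is parallel to column
        -- `j` of `Y`. The latter is not parallel to `u` in these rows, so w = 0. A single field
        -- element thus identifies a shift, which leaves at most q of them.
        rank≤1-shift-unique : ∀ x h h′ i i′ j →
          span x i j ⊗ lookup u i′ ≢ span x i′ j ⊗ lookup u i →
          Columns∥ u h → Columns∥ u h′ →
          RankAtMostOne (span (x +ᵛ h)) → RankAtMostOne (span (x +ᵛ h′)) →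
          span h i₀ j ≡ span h′ i₀ j → h ≡ h′
        rank≤1-shift-unique x h h′ i i′ j x∦u ∥h ∥h′ rank rank′ eq =
          sym (columns∥-injective h′ h ∥h′ ∥h λ k → begin
            span h′ i₀ k               ≡⟨ cong (λ z → span z i₀ k) (sym (-ᵛ-+ᵛ h′ h)) ⟩
            span (g +ᵛ h) i₀ k         ≡⟨ span-+ᵛ g h i₀ k ⟩
            span g i₀ k ⊕ span h i₀ k  ≡⟨ cong (_⊕ span h i₀ k) (g≡0 k) ⟩
            0F ⊕ span h i₀ k           ≡⟨ ⊕-identityˡ _ ⟩
            span h i₀ k                ∎)
          where
          open ≡-Reasoning
          g = h′ -ᵛ h
          Y = span (x +ᵛ h)
          ∥g : Columns∥ u g
          ∥g = columns∥-difference u h′ h ∥h′ ∥h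
          g-column : ∀ i → span g i j ≡ 0F
          g-column i = ⊗-cancelʳ (lookup u i₀) u≢0 (begin
            span g i j ⊗ lookup u i₀ ≡⟨ ∥g i i₀ j ⟩
            span g i₀ j ⊗ lookup u i ≡⟨ cong (_⊗ lookup u i) g-entry ⟩
            0F ⊗ lookup u i          ≡⟨ trans (⊗-zeroˡ _) (sym (⊗-zeroˡ _)) ⟩
            0F ⊗ lookup u i₀         ∎)
            where
            g-entry : span g i₀ j ≡ 0F
            g-entry = ⊕-cancelʳ (span h i₀ j) _ _ (begin
              span g i₀ j ⊕ span h i₀ j ≡⟨ sym (span-+ᵛ g h i₀ j) ⟩
              span (g +ᵛ h) i₀ j        ≡⟨ cong (λ z → span z i₀ j) (-ᵛ-+ᵛ h′ h) ⟩
              span h′ i₀ j              ≡⟨ sym eq ⟩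
              span h i₀ j               ≡⟨ sym (⊕-identityˡ _) ⟩
              0F ⊕ span h i₀ j          ∎)
          shifted : ∀ i k → span (x +ᵛ h′) i k ≡ Y i k ⊕ span g i k
          shifted i k = begin
            span (x +ᵛ h′) i k                     ≡⟨ span-+ᵛ x h′ i k ⟩
            span x i k ⊕ span h′ i k               ≡⟨ cong (λ z → span x i k ⊕ span z i k) (sym (-ᵛ-+ᵛ h′ h)) ⟩
            span x i k ⊕ span (g +ᵛ h) i k         ≡⟨ cong (span x i k ⊕_) (span-+ᵛ g h i k) ⟩
            span x i k ⊕ (span g i k ⊕ span h i k) ≡⟨ cong (span x i k ⊕_) (⊕-comm _ _) ⟩
            span x i k ⊕ (span h i k ⊕ span g i k) ≡⟨ sym (⊕-assoc _ _ _) ⟩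
            span x i k ⊕ span h i k ⊕ span g i k   ≡⟨ cong (_⊕ span g i k) (sym (span-+ᵛ x h i k)) ⟩
            Y i k ⊕ span g i k                     ∎
          shifted-column : ∀ i → span (x +ᵛ h′) i j ≡ Y i j
          shifted-column i = trans (shifted i j)
            (trans (cong (Y i j ⊕_) (g-column i)) (⊕-identityʳ _))
          rows∥ : ∀ k → Y i j ⊗ span g i′ k ≡ span g i k ⊗ Y i′ j
          rows∥ k = ⊕-cancelˡ (Y i j ⊗ Y i′ k) _ _ (begin
            Y i j ⊗ Y i′ k ⊕ Y i j ⊗ span g i′ k         ≡⟨ sym (⊗-distribˡ-⊕ (Y i j) _ _) ⟩
            Y i j ⊗ (Y i′ k ⊕ span g i′ k)               ≡⟨ cong₂ _⊗_ (sym (shifted-column i)) (sym (shifted i′ k)) ⟩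
            span (x +ᵛ h′) i j ⊗ span (x +ᵛ h′) i′ k     ≡⟨ rank′ i i′ j k ⟩
            span (x +ᵛ h′) i k ⊗ span (x +ᵛ h′) i′ j     ≡⟨ cong₂ _⊗_ (shifted i k) (shifted-column i′) ⟩
            (Y i k ⊕ span g i k) ⊗ Y i′ j                ≡⟨ ⊗-distribʳ-⊕ (Y i′ j) _ _ ⟩
            Y i k ⊗ Y i′ j ⊕ span g i k ⊗ Y i′ j         ≡⟨ cong (_⊕ span g i k ⊗ Y i′ j) (sym (rank i i′ j k)) ⟩
            Y i j ⊗ Y i′ k ⊕ span g i k ⊗ Y i′ j         ∎)
          Y∦u : Y i j ⊗ lookup u i′ ≢ Y i′ j ⊗ lookup u i
          Y∦u Y∥u = x∦u (columns∥-+ᵛ⁻ u x h i i′ j ∥h Y∥u)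
          g≡0 : ∀ k → span g i₀ k ≡ 0F
          g≡0 k = equalizer⇒0 (span g i₀ k) Y∦u (begin
            span g i₀ k ⊗ (Y i j ⊗ lookup u i′)  ≡⟨ solve 3 (λ g y u → g :* (y :* u) := y :* (g :* u)) refl (span g i₀ k) (Y i j) (lookup u i′) ⟩
            Y i j ⊗ (span g i₀ k ⊗ lookup u i′)  ≡⟨ cong (Y i j ⊗_) (sym (∥g i′ i₀ k)) ⟩
            Y i j ⊗ (span g i′ k ⊗ lookup u i₀)  ≡⟨ sym (⊗-assoc _ _ _) ⟩
            Y i j ⊗ span g i′ k ⊗ lookup u i₀    ≡⟨ cong (_⊗ lookup u i₀) (rows∥ k) ⟩
            span g i k ⊗ Y i′ j ⊗ lookup u i₀    ≡⟨ solve 3 (λ g y u → g :* y :* u := y :* (g :* u)) refl (span g i k) (Y i′ j) (lookup u i₀) ⟩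
            Y i′ j ⊗ (span g i k ⊗ lookup u i₀)  ≡⟨ cong (Y i′ j ⊗_) (∥g i i₀ k) ⟩
            Y i′ j ⊗ (span g i₀ k ⊗ lookup u i)  ≡⟨ solve 3 (λ g y u → y :* (g :* u) := g :* (y :* u)) refl (span g i₀ k) (Y i′ j) (lookup u i) ⟩
            span g i₀ k ⊗ (Y i′ j ⊗ lookup u i)  ∎)

        shift-count : ∀ x → ¬ Columns∥ u x →
          count (λ h → columns∥? u h ×-dec rankAtMostOne? (span (x +ᵛ h))) ≤ q
        shift-count x x∦u =
          let i , i′ , j , x≢ = ¬columns∥ u x x∦u
          in ≤-trans
            (count≤card-injective (λ h → columns∥? u h ×-dec rankAtMostOne? (span (x +ᵛ h)))
              (λ h → span h i₀ j)
              (λ h h′ (∥h , rank) (∥h′ , rank′) eq →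
                rank≤1-shift-unique x h h′ i i′ j x≢ ∥h ∥h′ rank rank′ eq))
            (≤-reflexive card-K)

        -- One inequality for both kinds of cosets: inside D_u all A shifts are allowed, outside at
        -- most q are. The indicator on the left stands for the subtraction in (q^r - A) q.
        pair-count-≤ : let A = count (columns∥? u) in ∀ x →
          count (λ h → columns∥? u h ×-dec rankAtMostOne? (span (x +ᵛ h))) + 𝟙 (columns∥? u x) * q
            ≤ 𝟙 (columns∥? u x) * A + q
        pair-count-≤ x = bound (columns∥? u x)
          where
          G = count (λ h → columns∥? u h ×-dec rankAtMostOne? (span (x +ᵛ h)))
          bound : (∥x? : Dec (Columns∥ u x)) → G + 𝟙 ∥x? * q ≤ 𝟙 ∥x? * count (columns∥? u) + q
          bound (yes _) = +-mono-≤
            (≤-trans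
              (count-injective (λ h → columns∥? u h ×-dec rankAtMostOne? (span (x +ᵛ h))) (columns∥? u)
                (λ h → h) (λ _ → proj₁) (λ _ _ _ _ eq → eq))
              (≤-reflexive (sym (*-identityˡ _))))
            (≤-reflexive (*-identityˡ q))
          bound (no x∦u) = ≤-trans (≤-reflexive (+-identityʳ G)) (shift-count x x∦u)

        -- Each translation by `h` permutes D, so every `h` in D_u meets all N matrices of rank at
        -- most one. Letting `x` run over all of D replaces a choice of coset representatives.
        pair-count : let A = count (columns∥? u) ; N = count (λ x → rankAtMostOne? (span x)) in
          A * N ≡ ∑ (λ x → count (λ h → columns∥? u h ×-dec rankAtMostOne? (span (x +ᵛ h))))
        pair-count = begin
          ∑ D * N
            ≡⟨ sym (∑-*ʳ D N) ⟩
          ∑ (λ h → D h * N)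
            ≡⟨ ∑-cong (λ h → cong (D h *_) (sym (∑-reindex (_+ᵛ h) (_-ᵛ h)
                 (λ x → -ᵛ-+ᵛ x h) (λ x → +ᵛ--ᵛ x h) R))) ⟩
          ∑ (λ h → D h * ∑ (λ x → R (x +ᵛ h)))
            ≡⟨ ∑-cong (λ h → sym (∑-*ˡ (D h) (λ x → R (x +ᵛ h)))) ⟩
          ∑ (λ h → ∑ (λ x → D h * R (x +ᵛ h)))
            ≡⟨ ∑-swap (λ h x → D h * R (x +ᵛ h)) ⟩
          ∑ (λ x → ∑ (λ h → D h * R (x +ᵛ h)))
            ≡⟨ ∑-cong (λ x → ∑-cong (λ h → sym (𝟙-× (columns∥? u h) (rankAtMostOne? (span (x +ᵛ h)))))) ⟩
          ∑ (λ x → count (λ h → columns∥? u h ×-dec rankAtMostOne? (span (x +ᵛ h)))) ∎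
          where
          open ≡-Reasoning
          D R : Vec K r → ℕ
          D h = 𝟙 (columns∥? u h)
          R x = 𝟙 (rankAtMostOne? (span x))
          N = ∑ R

        double-count : let A = count (columns∥? u) ; N = count (λ x → rankAtMostOne? (span x)) in
          A * N + A * q ≤ A * A + q ^ r * q
        double-count = begin
          A * N + A * q
            ≡⟨ cong₂ _+_ pair-count (sym (∑-*ʳ D q)) ⟩
          ∑ G + ∑ (λ x → D x * q)
            ≡⟨ sym (∑-+ G (λ x → D x * q)) ⟩
          ∑ (λ x → G x + D x * q)
            ≤⟨ ∑-mono pair-count-≤ ⟩
          ∑ (λ x → D x * A + q)
            ≡⟨ ∑-+ (λ x → D x * A) (λ _ → q) ⟩
          ∑ (λ x → D x * A) + ∑ {Vec K r} (λ _ → q)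
            ≡⟨ cong₂ _+_ (∑-*ʳ D A) (trans (∑-const {Vec K r} q) (cong (_* q) (card-Kⁿ r))) ⟩
          A * A + q ^ r * q ∎
          where
          open ≤-Reasoning
          D G : Vec K r → ℕ
          D x = 𝟙 (columns∥? u x)
          G x = count (λ h → columns∥? u h ×-dec rankAtMostOne? (span (x +ᵛ h)))
          A N : ℕ
          A = count (columns∥? u)
          N = count (λ x → rankAtMostOne? (span x))

        -- D_u contains all combinations of `x` and `y`, and two coordinates with nonzero
        -- determinant separate the q² coefficient pairs.
        count-columns∥-≥ : ∀ x y → Columns∥ u x → Columns∥ u y → ¬ Parallel x y →
          q * q ≤ count (columns∥? u)
        count-columns∥-≥ x y ∥x ∥y x∦y = ≤-trans
          (≤-reflexive (sym (trans (card-× K K) (cong₂ _*_ card-K card-K))))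
          (card≤count-injective {K × K} (columns∥? u) (λ (a , b) → a *ᵛ x +ᵛ b *ᵛ y)
            (λ (a , b) → columns∥-combination u x y a b ∥x ∥y)
            λ (a , b) (a′ , b′) eq →
              let s , t , det≢0 = nonzero-det x y x∦y
                  a≡a′ , b≡b′ = cramer det≢0 (entry a b a′ b′ eq s) (entry a b a′ b′ eq t)
              in cong₂ _,_ a≡a′ b≡b′)
          where
          lookup-combination : ∀ a b s → lookup (a *ᵛ x +ᵛ b *ᵛ y) s ≡ a ⊗ lookup x s ⊕ b ⊗ lookup y s
          lookup-combination a b s = trans (lookup-zipWith _⊕_ s (a *ᵛ x) (b *ᵛ y))
            (cong₂ _⊕_ (lookup-map s (a ⊗_) x) (lookup-map s (b ⊗_) y))
          entry : ∀ a b a′ b′ → a *ᵛ x +ᵛ b *ᵛ y ≡ a′ *ᵛ x +ᵛ b′ *ᵛ y → ∀ s →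
            a ⊗ lookup x s ⊕ b ⊗ lookup y s ≡ a′ ⊗ lookup x s ⊕ b′ ⊗ lookup y s
          entry a b a′ b′ eq s = trans (sym (lookup-combination a b s))
            (trans (cong (λ v → lookup v s) eq) (lookup-combination a′ b′ s))

      -- For a matrix of rank one this is a nonzero multiple of the column factor, depending
      -- homogeneously on x; so x is recovered from it unless some column space contains
      -- two independent elements.
      columnFactor : Vec K r → Vec K ℓ
      columnFactor x = tabulate (λ i → lead (span x i))

      lookup-columnFactor : ∀ x i → lookup (columnFactor x) i ≡ lead (span x i)
      lookup-columnFactor x i = lookup∘tabulate (λ i → lead (span x i)) i

      columnFactor-columns∥ : ∀ x → RankAtMostOne (span x) → Columns∥ (columnFactor x) x
      columnFactor-columns∥ x rank i i′ j = begin
        span x i j ⊗ lookup (columnFactor x) i′ ≡⟨ cong (span x i j ⊗_) (lookup-columnFactor x i′) ⟩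
        span x i j ⊗ lead (span x i′)           ≡⟨ sym (lead-⊗ (span x i j) (span x i′)) ⟩
        lead (λ k → span x i j ⊗ span x i′ k)   ≡⟨ lead-cong (λ k → trans (rank i i′ j k) (⊗-comm _ _)) ⟩
        lead (λ k → span x i′ j ⊗ span x i k)   ≡⟨ lead-⊗ (span x i′ j) (span x i) ⟩
        span x i′ j ⊗ lead (span x i)           ≡⟨ cong (span x i′ j ⊗_) (sym (lookup-columnFactor x i)) ⟩
        span x i′ j ⊗ lookup (columnFactor x) i ∎
        where open ≡-Reasoning

      columnFactor≡0 : ∀ x → columnFactor x ≡ 0ᵛ → x ≡ 0ᵛ
      columnFactor≡0 x eq = independent x λ i → lead≡0⇒zero
        (trans (sym (lookup-columnFactor x i)) (trans (cong (λ v → lookup v i) eq) (lookup-replicate i 0F)))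

      -- With `lookup x s` nonzero, parallelism says that x_s y = y_s x. Applying the homogeneous
      -- `columnFactor` gives x_s φ = y_s φ for the common nonzero factor φ, so x_s = y_s and the
      -- vectors agree.
      columnFactor-parallel : ∀ x y → Parallel x y → columnFactor x ≡ columnFactor y → x ≡ y
      columnFactor-parallel x y x∥y eq with columnFactor x ≟ 0ᵛ
      ... | yes φx≡0 = trans (columnFactor≡0 x φx≡0) (sym (columnFactor≡0 y (trans (sym eq) φx≡0)))
      ... | no φx≢0  = lookup-ext λ t → ⊗-cancelˡ (lookup x s) xs≢0 (begin
        lookup x s ⊗ lookup x t ≡⟨ ⊗-comm _ _ ⟩
        lookup x t ⊗ lookup x s ≡⟨ cong (lookup x t ⊗_) xs≡ys ⟩
        lookup x t ⊗ lookup y s ≡⟨ sym (x∥y s t) ⟩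
        lookup x s ⊗ lookup y t ∎)
        where
        open ≡-Reasoning
        i : Fin ℓ
        i = proj₁ (nonzero-entry (columnFactor x) φx≢0)
        φxi≢0 : lookup (columnFactor x) i ≢ 0F
        φxi≢0 = proj₂ (nonzero-entry (columnFactor x) φx≢0)
        x≢0 : x ≢ 0ᵛ
        x≢0 x≡0 = φxi≢0 (trans (lookup-columnFactor x i)
          (lead-zero (λ j → trans (cong (λ z → span z i j) x≡0) (dot-0ᵛ (λ t → fs t i j)))))
        s : Fin r
        s = proj₁ (nonzero-entry x x≢0)
        xs≢0 : lookup x s ≢ 0F
        xs≢0 = proj₂ (nonzero-entry x x≢0)
        scaled : lookup x s *ᵛ y ≡ lookup y s *ᵛ x
        scaled = lookup-ext λ t → begin
          lookup (lookup x s *ᵛ y) t ≡⟨ lookup-map t _ y ⟩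
          lookup x s ⊗ lookup y t    ≡⟨ x∥y s t ⟩
          lookup x t ⊗ lookup y s    ≡⟨ ⊗-comm _ _ ⟩
          lookup y s ⊗ lookup x t    ≡⟨ sym (lookup-map t _ x) ⟩
          lookup (lookup y s *ᵛ x) t ∎
        columnFactor-*ᵛ : ∀ c z → lead (span (c *ᵛ z) i) ≡ c ⊗ lookup (columnFactor z) i
        columnFactor-*ᵛ c z = trans (lead-cong (span-*ᵛ c z i))
          (trans (lead-⊗ c (span z i)) (cong (c ⊗_) (sym (lookup-columnFactor z i))))
        xs≡ys : lookup x s ≡ lookup y s
        xs≡ys = ⊗-cancelʳ (lookup (columnFactor x) i) φxi≢0 (begin
          lookup x s ⊗ lookup (columnFactor x) i ≡⟨ cong (λ v → lookup x s ⊗ lookup v i) eq ⟩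
          lookup x s ⊗ lookup (columnFactor y) i ≡⟨ sym (columnFactor-*ᵛ (lookup x s) y) ⟩
          lead (span (lookup x s *ᵛ y) i)        ≡⟨ cong (λ z → lead (span z i)) scaled ⟩
          lead (span (lookup y s *ᵛ x) i)        ≡⟨ columnFactor-*ᵛ (lookup y s) x ⟩
          lookup y s ⊗ lookup (columnFactor x) i ∎)

      -- A witness that D_u has dimension at least two. All three vectors sit in one finite type, so
      -- the case distinction is settled by a single exhaustive `search`.
      IndependentPair : Vec K ℓ × (Vec K r × Vec K r) → Set
      IndependentPair (u , x , y) = u ≢ 0ᵛ × Columns∥ u x × Columns∥ u y × ¬ Parallel x y

      independentPair? : ∀ t → Dec (IndependentPair t)
      independentPair? (u , x , y) =
        ¬? (u ≟ 0ᵛ) ×-dec columns∥? u x ×-dec columns∥? u y ×-dec ¬? (parallel? x y)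

      no-independentPair : (∀ t → ¬ IndependentPair t) →
        count (λ x → rankAtMostOne? (span x)) ≤ q ^ ℓ
      no-independentPair none = ≤-trans
        (count≤card-injective (λ x → rankAtMostOne? (span x)) columnFactor injective)
        (≤-reflexive (card-Kⁿ ℓ))
        where
        injective : ∀ x y → RankAtMostOne (span x) → RankAtMostOne (span y) →
          columnFactor x ≡ columnFactor y → x ≡ y
        injective x y rank-x rank-y eq with columnFactor x ≟ 0ᵛ | parallel? x y
        ... | yes φx≡0 | _       = trans (columnFactor≡0 x φx≡0) (sym (columnFactor≡0 y (trans (sym eq) φx≡0)))
        ... | no _     | yes x∥y = columnFactor-parallel x y x∥y eq
        ... | no φx≢0  | no x∦y  = contradiction
          (φx≢0 , columnFactor-columns∥ x rank-x ,
            subst (λ u → Columns∥ u y) (sym eq) (columnFactor-columns∥ y rank-y) , x∦y)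
          (none (columnFactor x , x , y))

      -- `m ≤ r′` places A below Y = q ^ r′ in `extremal`; together with `ℓ ≤ m` it also covers the
      -- case without an independent pair. Splitting off `r ≡ suc r′` lets q ^ r compute to q * Y.
      rank≤1-count : ∀ r′ → r ≡ suc r′ → ℓ ≤ m → m ≤ r′ →
        count (λ x → rankAtMostOne? (span x)) + q ≤ q ^ r′ + q * q
      rank≤1-count r′ refl ℓ≤m m≤r′ with search independentPair?
      ... | inj₂ none = +-mono-≤
        (≤-trans (no-independentPair none) (^-monoʳ-≤ q (≤-trans ℓ≤m m≤r′)))
        (m≤m*n q q)
      ... | inj₁ ((u , x , y) , u≢0 , ∥x , ∥y , x∦y) =
        let i₀ , ui₀≢0 = nonzero-entry u u≢0 in
        extremal (count (columns∥? u)) (count (λ x → rankAtMostOne? (span x))) (q ^ r′)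
          (count-columns∥-≥ u i₀ ui₀≢0 x y ∥x ∥y x∦y)
          (≤-trans (count-columns∥-≤ u i₀ ui₀≢0) (^-monoʳ-≤ q m≤r′))
          (double-count u i₀ ui₀≢0)

-- Support weights

∣S∣≡count : ∀ {n} (S : Subset n) → ∣ S ∣ ≡ count (_∈? S)
∣S∣≡count []          = sym (∑-Fin-zero _)
∣S∣≡count (true ∷ S)  = trans (cong suc (∣S∣≡count S)) (sym (∑-Fin-suc _))
∣S∣≡count (false ∷ S) = trans (∣S∣≡count S) (sym (∑-Fin-suc _))

module Weights (F : FiniteField) where
  open FiniteField F renaming
    (Carrier to K; _+_ to _⊕_; _*_ to _⊗_; -_ to ⊖_; size to q)
  open LinearAlgebra F
  open Subspaces F
  open Solver using (solve; _:=_; _:+_; _:*_)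

  -- The decision is an argument so that `vanishing?` and `leftKernel?` can both be supplied, one
  -- for each order of counting in `weight-identity`.
  nonvanishing-count : ∀ {n} (a : Fin n → K) (a≡0? : Dec (∀ i → a i ≡ 0F)) →
    q * count (λ v → ¬? (dot v a ≟ 0F)) ≡ 𝟙 (¬? a≡0?) * (p * q ^ n)
  nonvanishing-count {n} a (yes a≡0) = trans
    (cong (q *_) (count-none (λ v → ¬? (dot v a ≟ 0F)) (λ v v≢0 → v≢0 (dot-zero v a≡0))))
    (*-zeroʳ q)
  nonvanishing-count {n} a (no a≢0) =
    let i , ai≢0 = Fin.¬∀⟶∃¬ _ _ (λ i → a i ≟ 0F) a≢0
    in trans (count-nonzeros a i ai≢0) (sym (*-identityˡ (p * q ^ n)))

  -- Factorizations of matrices of rank one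

  outer : ∀ {ℓ m} → Vec K ℓ → Vec K m → Mat ℓ m
  outer u v i j = lookup u i ⊗ lookup v j

  eval-outer : ∀ {ℓ m} (M : Mat ℓ m) u v → eval M (outer u v) ≡ dot u (λ i → dot v (M i))
  eval-outer M u v = sumF-cong λ i → trans
    (sumF-cong λ j → solve 3 (λ x y z → x :* (y :* z) := y :* (z :* x)) refl
      (M i j) (lookup u i) (lookup v j))
    (sumF-⊗ (lookup u i) (λ j → lookup v j ⊗ M i j))

  eval-scalar : ∀ {ℓ m} (M : Mat ℓ m) {P Q : Mat ℓ m} c → (∀ i j → P i j ≡ c ⊗ Q i j) →
    eval M P ≡ c ⊗ eval M Q
  eval-scalar M {P} {Q} c P≡cQ = trans
    (sumF-cong λ i → trans
      (sumF-cong λ j → trans (cong (M i j ⊗_) (P≡cQ i j))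
        (solve 3 (λ x y z → x :* (y :* z) := y :* (x :* z)) refl (M i j) c (Q i j)))
      (sumF-⊗ c (λ j → M i j ⊗ Q i j)))
    (sumF-⊗ c (λ i → sumF (λ j → M i j ⊗ Q i j)))

  outer-rankOne : ∀ {ℓ m} (u : Vec K ℓ) (v : Vec K m) i j →
    lookup u i ≢ 0F → lookup v j ≢ 0F → RankOne (outer u v)
  outer-rankOne u v i j ui≢0 vj≢0 = (i , j , ⊗-≢0 ui≢0 vj≢0) , λ i i′ j j′ →
    solve 4 (λ a b c d → a :* b :* (c :* d) := a :* d :* (c :* b)) refl
      (lookup u i) (lookup v j) (lookup u i′) (lookup v j′)

  count-nonzero : count (λ (a : K) → ¬? (a ≟ 0F)) ≡ p
  count-nonzero = suc-injective (begin
    suc (count (λ a → ¬? (a ≟ 0F)))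
      ≡⟨ cong (_+ count (λ a → ¬? (a ≟ 0F))) (sym (Finite.once finite-K 0F)) ⟩
    count (λ a → a ≟ 0F) + count (λ a → ¬? (a ≟ 0F))
      ≡⟨ count-¬ (λ a → a ≟ 0F) ⟩
    card K
      ≡⟨ trans card-K q≡1+p ⟩
    suc p ∎)
    where open ≡-Reasoning

  BothNonzero : K × K → Set
  BothNonzero (a , b) = a ≢ 0F × b ≢ 0F

  bothNonzero? : ∀ s → Dec (BothNonzero s)
  bothNonzero? (a , b) = ¬? (a ≟ 0F) ×-dec ¬? (b ≟ 0F)

  count-bothNonzero : count bothNonzero? ≡ p * p
  count-bothNonzero = begin
    count bothNonzero?
      ≡⟨ ∑-× (λ s → 𝟙 (bothNonzero? s)) ⟩
    ∑ {K} (λ a → ∑ {K} (λ b → 𝟙 (bothNonzero? (a , b))))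
      ≡⟨ ∑-cong (λ a → ∑-cong (λ b → 𝟙-× (¬? (a ≟ 0F)) (¬? (b ≟ 0F)))) ⟩
    ∑ {K} (λ a → ∑ {K} (λ b → 𝟙 (¬? (a ≟ 0F)) * 𝟙 (¬? (b ≟ 0F))))
      ≡⟨ ∑-cong (λ a → ∑-*ˡ (𝟙 (¬? (a ≟ 0F))) (λ b → 𝟙 (¬? (b ≟ 0F)))) ⟩
    ∑ {K} (λ a → 𝟙 (¬? (a ≟ 0F)) * count (λ (b : K) → ¬? (b ≟ 0F)))
      ≡⟨ ∑-*ʳ (λ a → 𝟙 (¬? (a ≟ 0F))) _ ⟩
    count (λ (a : K) → ¬? (a ≟ 0F)) * count (λ (b : K) → ¬? (b ≟ 0F))
      ≡⟨ cong₂ _*_ count-nonzero count-nonzero ⟩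
    p * p ∎
    where open ≡-Reasoning

  scalarMultiple? : ∀ {ℓ m} (M N : Mat ℓ m) → Dec (ScalarMultiple M N)
  scalarMultiple? M N = ∃? λ c → ¬? (c ≟ 0F) ×-dec Fin.all? λ i → Fin.all? λ j → M i j ≟ c ⊗ N i j

  module _ {ℓ m : ℕ} (M : Mat ℓ m) where

    Factorization : Vec K ℓ × Vec K m → Set
    Factorization (u , v) = ScalarMultiple (outer u v) M

    factorization? : ∀ s → Dec (Factorization s)
    factorization? (u , v) = scalarMultiple? (outer u v) M

    module _ (i₀ : Fin ℓ) (j₀ : Fin m) (pivot≢0 : M i₀ j₀ ≢ 0F)
             (rank : RankAtMostOne M) where

      -- The two entries `lookup u i₀` and `lookup v j₀` determine the pair: their product fixes the
      -- scalar at the pivot, after which column `j₀` gives `u` and row `i₀` gives `v`.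
      count-factorizations-≤ : count factorization? ≤ p * p
      count-factorizations-≤ = ≤-trans
        (count-injective factorization? bothNonzero? (λ (u , v) → lookup u i₀ , lookup v j₀)
          (λ (u , v) (c , c≢0 , eq) →
            let uv≢0 = subst (_≢ 0F) (sym (eq i₀ j₀)) (⊗-≢0 c≢0 pivot≢0)
            in ≢0-⊗ˡ uv≢0 , ≢0-⊗ʳ uv≢0)
          injective)
        (≤-reflexive count-bothNonzero)
        where
        injective : ∀ s t → Factorization s → Factorization t →
          (lookup (proj₁ s) i₀ , lookup (proj₂ s) j₀) ≡ (lookup (proj₁ t) i₀ , lookup (proj₂ t) j₀) →
          s ≡ t
        injective (u , v) (u′ , v′) (c , c≢0 , eq) (c′ , c′≢0 , eq′) same = cong₂ _,_
          (lookup-ext λ i → ⊗-cancelʳ (lookup v j₀) (≢0-⊗ʳ uv≢0) (begin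
            lookup u i ⊗ lookup v j₀   ≡⟨ trans (eq i j₀) (trans (cong (_⊗ M i j₀) c≡c′) (sym (eq′ i j₀))) ⟩
            lookup u′ i ⊗ lookup v′ j₀ ≡⟨ cong (lookup u′ i ⊗_) (sym v≡v′) ⟩
            lookup u′ i ⊗ lookup v j₀  ∎))
          (lookup-ext λ j → ⊗-cancelˡ (lookup u i₀) (≢0-⊗ˡ uv≢0) (begin
            lookup u i₀ ⊗ lookup v j   ≡⟨ trans (eq i₀ j) (trans (cong (_⊗ M i₀ j) c≡c′) (sym (eq′ i₀ j))) ⟩
            lookup u′ i₀ ⊗ lookup v′ j ≡⟨ cong (_⊗ lookup v′ j) (sym u≡u′) ⟩
            lookup u i₀ ⊗ lookup v′ j  ∎))
          where
          open ≡-Reasoning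
          u≡u′ : lookup u i₀ ≡ lookup u′ i₀
          u≡u′ = cong proj₁ same
          v≡v′ : lookup v j₀ ≡ lookup v′ j₀
          v≡v′ = cong proj₂ same
          uv≢0 : lookup u i₀ ⊗ lookup v j₀ ≢ 0F
          uv≢0 = subst (_≢ 0F) (sym (eq i₀ j₀)) (⊗-≢0 c≢0 pivot≢0)
          c≡c′ : c ≡ c′
          c≡c′ = ⊗-cancelʳ (M i₀ j₀) pivot≢0
            (trans (sym (eq i₀ j₀)) (trans (cong₂ _⊗_ u≡u′ v≡v′) (eq′ i₀ j₀)))

      -- Column `j₀` and row `i₀` may be scaled independently. Their outer product is `M` times the
      -- pivot and both scalars, because the minors through the pivot vanish.
      count-factorizations-≥ : p * p ≤ count factorization?
      count-factorizations-≥ = ≤-trans (≤-reflexive (sym count-bothNonzero))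
        (count-injective bothNonzero? factorization? (λ (a , b) → a *ᵛ column , b *ᵛ row)
          (λ (a , b) (a≢0 , b≢0) → a ⊗ b ⊗ M i₀ j₀ , ⊗-≢0 (⊗-≢0 a≢0 b≢0) pivot≢0 , λ i j → begin
            lookup (a *ᵛ column) i ⊗ lookup (b *ᵛ row) j ≡⟨ cong₂ _⊗_ (lookup-column a i) (lookup-row b j) ⟩
            a ⊗ M i j₀ ⊗ (b ⊗ M i₀ j)                    ≡⟨ solve 4 (λ a b x y → a :* x :* (b :* y) := a :* b :* (x :* y)) refl a b (M i j₀) (M i₀ j) ⟩
            a ⊗ b ⊗ (M i j₀ ⊗ M i₀ j)                    ≡⟨ cong (a ⊗ b ⊗_) (trans (sym (rank i i₀ j j₀)) (⊗-comm _ _)) ⟩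
            a ⊗ b ⊗ (M i₀ j₀ ⊗ M i j)                    ≡⟨ sym (⊗-assoc _ _ _) ⟩
            a ⊗ b ⊗ M i₀ j₀ ⊗ M i j                      ∎)
          (λ (a , b) (a′ , b′) _ _ eq → cong₂ _,_
            (⊗-cancelʳ (M i₀ j₀) pivot≢0 (trans (sym (lookup-column a i₀))
              (trans (cong (λ s → lookup (proj₁ s) i₀) eq) (lookup-column a′ i₀))))
            (⊗-cancelʳ (M i₀ j₀) pivot≢0 (trans (sym (lookup-row b j₀))
              (trans (cong (λ s → lookup (proj₂ s) j₀) eq) (lookup-row b′ j₀))))))
        where
        open ≡-Reasoning
        column : Vec K ℓ
        column = tabulate (λ i → M i j₀)
        row : Vec K m
        row = tabulate (M i₀)
        lookup-column : ∀ a i → lookup (a *ᵛ column) i ≡ a ⊗ M i j₀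
        lookup-column a i = trans (lookup-map i (a ⊗_) column)
          (cong (a ⊗_) (lookup∘tabulate (λ i → M i j₀) i))
        lookup-row : ∀ b j → lookup (b *ᵛ row) j ≡ b ⊗ M i₀ j
        lookup-row b j = trans (lookup-map j (b ⊗_) row) (cong (b ⊗_) (lookup∘tabulate (M i₀) j))

    count-factorizations : RankOne M → count factorization? ≡ p * p
    count-factorizations ((i₀ , j₀ , pivot≢0) , rank) = ≤-antisym
      (count-factorizations-≤ i₀ j₀ pivot≢0 rank) (count-factorizations-≥ i₀ j₀ pivot≢0 rank)

  -- Averaging over the subspace

  module _ {ℓ m r : ℕ} (fs : Fin r → Mat ℓ m) where

    Vanishing : Vec K ℓ × Vec K m → Set
    Vanishing (u , v) = ∀ t → eval (fs t) (outer u v) ≡ 0F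

    vanishing? : ∀ s → Dec (Vanishing s)
    vanishing? (u , v) = Fin.all? λ t → eval (fs t) (outer u v) ≟ 0F

    span-bilinear : ∀ x u v →
      dot x (λ t → eval (fs t) (outer u v)) ≡ dot v (λ j → dot u (λ i → span fs x i j))
    span-bilinear x u v = begin
      dot x (λ t → eval (fs t) (outer u v))           ≡⟨ dot-cong x (λ t → eval-outer (fs t) u v) ⟩
      dot x (λ t → dot u (λ i → dot v (fs t i)))      ≡⟨ dot-swap x u (λ t i → dot v (fs t i)) ⟩
      dot u (λ i → dot x (λ t → dot v (fs t i)))      ≡⟨ dot-cong u (λ i → dot-swap x v (λ t j → fs t i j)) ⟩
      dot u (λ i → dot v (span fs x i))               ≡⟨ dot-swap u v (span fs x) ⟩
      dot v (λ j → dot u (λ i → span fs x i j))       ∎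
      where open ≡-Reasoning

    -- Both sides count the triples (x, u, v) with uᵀ (span x) v ≠ 0.
    weight-identity :
      q ^ r * count (λ s → ¬? (vanishing? s)) ≡
      q ^ m * ∑ (λ x → count (λ u → ¬? (leftKernel? (span fs x) u)))
    weight-identity = *-cancelˡ-≡ _ _ p (begin
      p * (q ^ r * S)
        ≡⟨ rearrange p (q ^ r) S ⟩
      S * (p * q ^ r)
        ≡⟨ sym (∑-*ʳ (λ s → 𝟙 (¬? (vanishing? s))) (p * q ^ r)) ⟩
      ∑ (λ s → 𝟙 (¬? (vanishing? s)) * (p * q ^ r))
        ≡⟨ ∑-cong (λ (u , v) → sym (nonvanishing-count (λ t → eval (fs t) (outer u v)) (vanishing? (u , v)))) ⟩
      ∑ {Vec K ℓ × Vec K m} (λ s → q * ∑ {Vec K r} (λ x → B x s))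
        ≡⟨ ∑-*ˡ {Vec K ℓ × Vec K m} q (λ s → ∑ {Vec K r} (λ x → B x s)) ⟩
      q * ∑ {Vec K ℓ × Vec K m} (λ s → ∑ {Vec K r} (λ x → B x s))
        ≡⟨ cong (q *_) (∑-swap {Vec K ℓ × Vec K m} {Vec K r} (λ s x → B x s)) ⟩
      q * ∑ {Vec K r} (λ x → ∑ {Vec K ℓ × Vec K m} (B x))
        ≡⟨ sym (∑-*ˡ {Vec K r} q (λ x → ∑ {Vec K ℓ × Vec K m} (B x))) ⟩
      ∑ {Vec K r} (λ x → q * ∑ {Vec K ℓ × Vec K m} (B x))
        ≡⟨ ∑-cong {Vec K r} by-matrix ⟩
      ∑ {Vec K r} (λ x → L x * (p * q ^ m))
        ≡⟨ ∑-*ʳ {Vec K r} L (p * q ^ m) ⟩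
      ∑ L * (p * q ^ m)
        ≡⟨ sym (rearrange p (q ^ m) (∑ L)) ⟩
      p * (q ^ m * ∑ L) ∎)
      where
      open ≡-Reasoning
      rearrange : ∀ p x s → p * (x * s) ≡ s * (p * x)
      rearrange = solve-∀
      S : ℕ
      S = count (λ s → ¬? (vanishing? s))
      B : Vec K r → Vec K ℓ × Vec K m → ℕ
      B x (u , v) = 𝟙 (¬? (dot x (λ t → eval (fs t) (outer u v)) ≟ 0F))
      L : Vec K r → ℕ
      L x = count (λ u → ¬? (leftKernel? (span fs x) u))
      by-matrix : ∀ x → q * ∑ {Vec K ℓ × Vec K m} (B x) ≡ L x * (p * q ^ m)
      by-matrix x = begin
        q * ∑ {Vec K ℓ × Vec K m} (B x)
          ≡⟨ cong (q *_) (∑-× (B x)) ⟩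
        q * ∑ {Vec K ℓ} (λ u → ∑ {Vec K m} (λ v → B x (u , v)))
          ≡⟨ sym (∑-*ˡ {Vec K ℓ} q (λ u → ∑ {Vec K m} (λ v → B x (u , v)))) ⟩
        ∑ {Vec K ℓ} (λ u → q * ∑ {Vec K m} (λ v → B x (u , v)))
          ≡⟨ ∑-cong {Vec K ℓ} (λ u → cong (q *_) (∑-cong {Vec K m} (λ v →
               cong (λ b → 𝟙 (¬? (b ≟ 0F))) (span-bilinear x u v)))) ⟩
        ∑ {Vec K ℓ} (λ u → q * count (λ v → ¬? (dot v (λ j → dot u (λ i → span fs x i j)) ≟ 0F)))
          ≡⟨ ∑-cong {Vec K ℓ} (λ u → nonvanishing-count (λ j → dot u (λ i → span fs x i j))
               (leftKernel? (span fs x) u)) ⟩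
        ∑ {Vec K ℓ} (λ u → 𝟙 (¬? (leftKernel? (span fs x) u)) * (p * q ^ m))
          ≡⟨ ∑-*ʳ {Vec K ℓ} (λ u → 𝟙 (¬? (leftKernel? (span fs x) u))) (p * q ^ m) ⟩
        L x * (p * q ^ m) ∎

    -- The bracket equals 1 in rank at least two, 1 + p = q in rank one and 1 + p + q p = q² at
    -- zero. Written with indicators, it can be summed over D and brings in N.
    kernel-weight : (∀ x → (∀ i j → span fs x i j ≡ 0F) → x ≡ 0ᵛ) → ∀ x →
      q * q * count (leftKernel? (span fs x)) ≤
      q ^ ℓ * (1 + p * 𝟙 (rankAtMostOne? (span fs x)) + q * p * 𝟙 (x ≟ 0ᵛ))
    kernel-weight independent x = bound (rankAtMostOne? (span fs x)) (x ≟ 0ᵛ)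
      where
      open ≤-Reasoning
      κ : ℕ
      κ = count (leftKernel? (span fs x))
      bound : (R : Dec (RankAtMostOne (span fs x))) (Z : Dec (x ≡ 0ᵛ)) →
        q * q * κ ≤ q ^ ℓ * (1 + p * 𝟙 R + q * p * 𝟙 Z)
      bound (no rank≥2) Z = begin
        q * q * κ                             ≤⟨ leftKernel-rank≥2 (span fs x) rank≥2 ⟩
        q ^ ℓ                                 ≡⟨ sym (*-identityʳ (q ^ ℓ)) ⟩
        q ^ ℓ * 1                             ≤⟨ *-monoʳ-≤ (q ^ ℓ) (s≤s z≤n) ⟩
        q ^ ℓ * (1 + p * 0 + q * p * 𝟙 Z)     ∎
      bound (yes _) (no x≢0) =
        let i , ¬row = Fin.¬∀⟶∃¬ _ _ (λ i → Fin.all? λ j → span fs x i j ≟ 0F)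
                         (λ all-zero → x≢0 (independent x all-zero))
            j , entry≢0 = Fin.¬∀⟶∃¬ _ _ (λ j → span fs x i j ≟ 0F) ¬row
        in begin
        q * q * κ                             ≡⟨ *-assoc q q κ ⟩
        q * (q * κ)                           ≤⟨ *-monoʳ-≤ q (leftKernel-nonzero (span fs x) i j entry≢0) ⟩
        q * q ^ ℓ                             ≡⟨ cong (_* q ^ ℓ) q≡1+p ⟩
        (1 + p) * q ^ ℓ                       ≡⟨ rearrange p q (q ^ ℓ) ⟩
        q ^ ℓ * (1 + p * 1 + q * p * 0)       ∎
        where
        rearrange : ∀ p q y → (1 + p) * y ≡ y * (1 + p * 1 + q * p * 0)
        rearrange = solve-∀
      bound (yes _) (yes _) = begin
        q * q * κ                             ≤⟨ *-monoʳ-≤ (q * q) (count≤card (leftKernel? (span fs x))) ⟩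
        q * q * card (Vec K ℓ)                ≡⟨ cong (q * q *_) (card-Kⁿ ℓ) ⟩
        q * q * q ^ ℓ                         ≡⟨ expand q p (q ^ ℓ) q≡1+p ⟩
        q ^ ℓ * (1 + p * 1 + q * p * 1)       ∎
        where
        expand : ∀ q p y → q ≡ suc p → q * q * y ≡ y * (1 + p * 1 + q * p * 1)
        expand q p y refl = identity p y
          where
          identity : ∀ p y → (1 + p) * (1 + p) * y ≡ y * (1 + p * 1 + (1 + p) * p * 1)
          identity = solve-∀

    kernel-sum : (∀ x → (∀ i j → span fs x i j ≡ 0F) → x ≡ 0ᵛ) →
      q * q * ∑ (λ x → count (leftKernel? (span fs x))) ≤
      q ^ ℓ * (q ^ r + p * count (λ x → rankAtMostOne? (span fs x)) + q * p)
    kernel-sum independent = begin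
      q * q * ∑ κ
        ≡⟨ sym (∑-*ˡ (q * q) κ) ⟩
      ∑ (λ x → q * q * κ x)
        ≤⟨ ∑-mono (kernel-weight independent) ⟩
      ∑ (λ x → q ^ ℓ * (1 + p * R x + q * p * Z x))
        ≡⟨ ∑-*ˡ (q ^ ℓ) (λ x → 1 + p * R x + q * p * Z x) ⟩
      q ^ ℓ * ∑ (λ x → 1 + p * R x + q * p * Z x)
        ≡⟨ cong (q ^ ℓ *_) (trans (∑-+ (λ x → 1 + p * R x) (λ x → q * p * Z x))
             (cong₂ _+_ (trans (∑-+ (λ _ → 1) (λ x → p * R x)) (cong₂ _+_ (card-Kⁿ r) (∑-*ˡ p R)))
               (trans (∑-*ˡ (q * p) Z) (trans (cong (q * p *_) (Finite.once finite-Vec 0ᵛ)) (*-identityʳ (q * p)))))) ⟩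
      q ^ ℓ * (q ^ r + p * ∑ R + q * p) ∎
      where
      open ≤-Reasoning
      κ R Z : Vec K r → ℕ
      κ x = count (leftKernel? (span fs x))
      R x = 𝟙 (rankAtMostOne? (span fs x))
      Z x = 𝟙 (x ≟ 0ᵛ)

    image-sum : ∑ (λ x → count (λ u → ¬? (leftKernel? (span fs x) u)))
      + ∑ (λ x → count (leftKernel? (span fs x))) ≡ q ^ r * q ^ ℓ
    image-sum = begin
      ∑ (λ x → count (λ u → ¬? (leftKernel? (span fs x) u))) + ∑ (λ x → count (leftKernel? (span fs x)))
        ≡⟨ sym (∑-+ (λ x → count (λ u → ¬? (leftKernel? (span fs x) u))) (λ x → count (leftKernel? (span fs x)))) ⟩
      ∑ (λ x → count (λ u → ¬? (leftKernel? (span fs x) u)) + count (leftKernel? (span fs x)))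
        ≡⟨ ∑-cong (λ x → trans (+-comm (count (λ u → ¬? (leftKernel? (span fs x) u))) _) (trans (count-¬ (leftKernel? (span fs x))) (card-Kⁿ ℓ))) ⟩
      ∑ {Vec K r} (λ _ → q ^ ℓ)
        ≡⟨ trans (∑-const {Vec K r} (q ^ ℓ)) (cong (_* q ^ ℓ) (card-Kⁿ r)) ⟩
      q ^ r * q ^ ℓ ∎
      where open ≡-Reasoning

    module _ {n : ℕ} (reps : Fin n → Mat ℓ m) (isReps : IsProjRankOneReps ℓ m n reps) where

      combo-vanishes : ∀ λs k → (∀ t → codeword reps (fs t) k ≡ 0F) → combo reps fs λs k ≡ 0F
      combo-vanishes λs k zero-word = trans
        (sumF-cong (λ t → trans (cong (λs t ⊗_) (zero-word t)) (⊗-zeroʳ _))) (sumF-0 r)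

      -- A generator that does not vanish at `k` is itself a combination, with unit coefficients.
      -- Membership in the support thereby becomes a finite, decidable condition on the generators.
      inSupport : ∀ k → ¬ (∀ t → codeword reps (fs t) k ≡ 0F) → InSupport reps fs k
      inSupport k ¬zero =
        let t , ct≢0 = Fin.¬∀⟶∃¬ _ _ (λ t → codeword reps (fs t) k ≟ 0F) ¬zero
        in lookup (unit t) , λ combo≡0 →
          ct≢0 (trans (sym (dot-unit t (λ t → codeword reps (fs t) k))) combo≡0)

      support⇒¬zero : ∀ k → InSupport reps fs k → ¬ (∀ t → codeword reps (fs t) k ≡ 0F)
      support⇒¬zero k (λs , combo≢0) zero-word = combo≢0 (combo-vanishes λs k zero-word)

      vanishing⇔zero : ∀ u v k → Factorization (reps k) (u , v) →
        (Vanishing (u , v) → ∀ t → codeword reps (fs t) k ≡ 0F) ×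
        ((∀ t → codeword reps (fs t) k ≡ 0F) → Vanishing (u , v))
      vanishing⇔zero u v k (c , c≢0 , eq) =
        (λ vanishing t → ⊗-cancelˡ c c≢0
          (trans (sym (eval-scalar (fs t) c eq)) (trans (vanishing t) (sym (⊗-zeroʳ c))))) ,
        (λ zero-word t → trans (eval-scalar (fs t) c eq) (trans (cong (c ⊗_) (zero-word t)) (⊗-zeroʳ c)))

      nonvanishing⇒rankOne : ∀ u v → ¬ Vanishing (u , v) → RankOne (outer u v)
      nonvanishing⇒rankOne u v ¬vanishing =
        let i , ui≢0 = nonzero-entry u u≢0
            j , vj≢0 = nonzero-entry v v≢0
        in outer-rankOne u v i j ui≢0 vj≢0
        where
        u≢0 : u ≢ 0ᵛ
        u≢0 refl = ¬vanishing λ t → trans (eval-outer (fs t) 0ᵛ v) (dot-0ᵛ (λ i → dot v (fs t i)))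
        v≢0 : v ≢ 0ᵛ
        v≢0 refl = ¬vanishing λ t → trans (eval-outer (fs t) u 0ᵛ) (dot-zero u (λ i → dot-0ᵛ (fs t i)))

      factorization-unique : ∀ s k k′ → Factorization (reps k) s → Factorization (reps k′) s → k ≡ k′
      factorization-unique (u , v) k k′ (c , c≢0 , eq) (c′ , c′≢0 , eq′) =
        -- The two representatives differ by the factor c′/c, where `d` is the inverse of `c`.
        proj₂ (proj₂ isReps) k k′ (d ⊗ c′ , ⊗-≢0 d≢0 c′≢0 , λ i j → ⊗-cancelˡ c c≢0 (begin
          c ⊗ reps k i j                 ≡⟨ trans (sym (eq i j)) (eq′ i j) ⟩
          c′ ⊗ reps k′ i j               ≡⟨ sym (⊗-identityˡ _) ⟩
          1F ⊗ (c′ ⊗ reps k′ i j)        ≡⟨ cong (_⊗ (c′ ⊗ reps k′ i j)) (sym cd≡1) ⟩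
          c ⊗ d ⊗ (c′ ⊗ reps k′ i j)     ≡⟨ solve 4 (λ c d e x → c :* d :* (e :* x) := c :* (d :* e :* x)) refl c d c′ (reps k′ i j) ⟩
          c ⊗ (d ⊗ c′ ⊗ reps k′ i j)     ∎))
        where
        open ≡-Reasoning
        d : K
        d = proj₁ (inverse c c≢0)
        cd≡1 : c ⊗ d ≡ 1F
        cd≡1 = proj₂ (inverse c c≢0)
        d≢0 : d ≢ 0F
        d≢0 = ≢0-⊗ʳ (subst (_≢ 0F) (sym cd≡1) (λ eq → 0≢1 (sym eq)))

      -- A nonvanishing pair has a rank one outer product and so belongs to exactly one
      -- representative, which lies in the support. Conversely, every supported representative has
      -- p² factorizations, all of them nonvanishing.
      supportWeight-count : ∀ s → SupportWeight reps fs s →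
        count (λ t → ¬? (vanishing? t)) ≡ s * (p * p)
      supportWeight-count s (S , S⇔ , ∣S∣≡s) = begin
        count (λ t → ¬? (vanishing? t))
          ≡⟨ ∑-cong {Vec K ℓ × Vec K m} (λ t → by-representative t (vanishing? t)) ⟩
        ∑ {Vec K ℓ × Vec K m} (λ t → ∑ {Fin n} (λ k → 𝟙 (here? t k)))
          ≡⟨ ∑-swap {Vec K ℓ × Vec K m} {Fin n} (λ t k → 𝟙 (here? t k)) ⟩
        ∑ {Fin n} (λ k → ∑ {Vec K ℓ × Vec K m} (λ t → 𝟙 (here? t k)))
          ≡⟨ ∑-cong {Fin n} (λ k → trans
               (∑-cong {Vec K ℓ × Vec K m} (λ t → 𝟙-× (k ∈? S) (factorization? (reps k) t)))
               (trans (∑-*ˡ {Vec K ℓ × Vec K m} (𝟙 (k ∈? S)) (λ t → 𝟙 (factorization? (reps k) t)))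
                 (cong (𝟙 (k ∈? S) *_) (count-factorizations (reps k) (proj₁ isReps k))))) ⟩
        ∑ {Fin n} (λ k → 𝟙 (k ∈? S) * (p * p))
          ≡⟨ ∑-*ʳ {Fin n} (λ k → 𝟙 (k ∈? S)) (p * p) ⟩
        count (_∈? S) * (p * p)
          ≡⟨ cong (_* (p * p)) (trans (sym (∣S∣≡count S)) ∣S∣≡s) ⟩
        s * (p * p) ∎
        where
        open ≡-Reasoning
        here? : ∀ t k → Dec (k ∈ S × Factorization (reps k) t)
        here? t k = (k ∈? S) ×-dec factorization? (reps k) t
        by-representative : ∀ t (vanishing : Dec (Vanishing t)) →
          𝟙 (¬? vanishing) ≡ count (here? t)
        by-representative (u , v) (yes vanishing) = sym (count-none (here? (u , v)) λ k (k∈S , factor) →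
          support⇒¬zero k (proj₁ (S⇔ k) k∈S) (proj₁ (vanishing⇔zero u v k factor) vanishing))
        by-representative (u , v) (no ¬vanishing) =
          let k , factor = proj₁ (proj₂ isReps) (outer u v) (nonvanishing⇒rankOne u v ¬vanishing)
          in sym (count-exactly-one (here? (u , v)) k
            (proj₂ (S⇔ k) (inSupport k (λ zero-word →
              ¬vanishing (proj₂ (vanishing⇔zero u v k factor) zero-word))) , factor)
            (λ k′ (_ , factor′) → factorization-unique (u , v) k′ k factor′ factor))

-- The lower bound for generalized weights

module GeneralizedWeights (F : FiniteField) where
  open FiniteField F renaming
    (Carrier to K; _+_ to _⊕_; _*_ to _⊗_; -_ to ⊖_; size to q)
  open LinearAlgebra F
  open Subspaces F
  open Weights F
  open Solver using (solve; _:=_; _:+_; _:*_)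

  -- The averaged weight inequality multiplied by p q, with the truncated subtractions removed
  -- from E = (q^r ∸ 1) + (x ∸ 1) p, where x = q^(r-2).
  average-bound : ∀ q p x E a b L κ N s → q ≡ suc p → NonZero p →
    E + q ≡ q * (q * x) + x * p →
    q * (q * x) * (s * (p * p)) ≡ b * L →
    L + κ ≡ q * (q * x) * a →
    q * q * κ ≤ a * (q * (q * x) + p * N + q * p) →
    N + q ≤ q * x + q * q →
    a * b * E ≤ s * (p * (q * (q * (q * x))))
  average-bound q p x E a b L κ N s refl p≢0 E≡ weight total kernels ranks =
    *-cancelˡ-≤ (p * q) {{m*n≢0 p q {{p≢0}}}} (begin
      p * q * (a * b * E)                       ≡⟨ move p q a b E ⟩
      b * (a * (E * (p * q)))                   ≤⟨ *-monoʳ-≤ b image-bound ⟩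
      b * (q * q * L)                           ≡⟨ pull b q L ⟩
      q * q * (b * L)                           ≡⟨ cong (q * q *_) (sym weight) ⟩
      q * q * (q * (q * x) * (s * (p * p)))     ≡⟨ move′ p q x s ⟩
      p * q * (s * (p * (q * (q * (q * x)))))   ∎)
    where
    open ≤-Reasoning
    move : ∀ p q a b E → p * q * (a * b * E) ≡ b * (a * (E * (p * q)))
    move = solve-∀
    pull : ∀ b q L → b * (q * q * L) ≡ q * q * (b * L)
    pull = solve-∀
    move′ : ∀ p q x s → q * q * (q * (q * x) * (s * (p * p))) ≡ p * q * (s * (p * (q * (q * (q * x)))))
    move′ = solve-∀
    -- Once q (p q) is added to both sides, the bound on N is the only inequality and the rest is an
    -- identity. So E is exactly the constant that this bound yields.
    per-functional : E * (p * q) + (q * (q * x) + p * N + q * p) ≤ q * q * (q * (q * x))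
    per-functional = +-cancelʳ-≤ (q * (p * q)) _ _ (begin
      E * (p * q) + (q * (q * x) + p * N + q * p) + q * (p * q)
        ≡⟨ regroup E q p x N ⟩
      (E + q) * (p * q) + q * (q * x) + p * (N + q)
        ≤⟨ +-mono-≤ (≤-reflexive (cong (λ e → e * (p * q) + q * (q * x)) E≡)) (*-monoʳ-≤ p ranks) ⟩
      (q * (q * x) + x * p) * (p * q) + q * (q * x) + p * (q * x + q * q)
        ≡⟨ identity p x ⟩
      q * q * (q * (q * x)) + q * (p * q) ∎)
      where
      regroup : ∀ E q p x N → E * (p * q) + (q * (q * x) + p * N + q * p) + q * (p * q) ≡
        (E + q) * (p * q) + q * (q * x) + p * (N + q)
      regroup = solve-∀
      identity : ∀ p x → let q = suc p in
        (q * (q * x) + x * p) * (p * q) + q * (q * x) + p * (q * x + q * q) ≡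
        q * q * (q * (q * x)) + q * (p * q)
      identity = solve-∀
    image-bound : a * (E * (p * q)) ≤ q * q * L
    image-bound = +-cancelʳ-≤ (q * q * κ) _ _ (begin
      a * (E * (p * q)) + q * q * κ
        ≤⟨ +-monoʳ-≤ (a * (E * (p * q))) kernels ⟩
      a * (E * (p * q)) + a * (q * (q * x) + p * N + q * p)
        ≡⟨ sym (*-distribˡ-+ a (E * (p * q)) _) ⟩
      a * (E * (p * q) + (q * (q * x) + p * N + q * p))
        ≤⟨ *-monoʳ-≤ a per-functional ⟩
      a * (q * q * (q * (q * x)))
        ≡⟨ pull′ a q x ⟩
      q * q * (q * (q * x) * a)
        ≡⟨ cong (q * q *_) (sym total) ⟩
      q * q * (L + κ)
        ≡⟨ *-distribˡ-+ (q * q) L κ ⟩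
      q * q * L + q * q * κ ∎)
      where
      pull′ : ∀ a q x → a * (q * q * (q * (q * x))) ≡ q * q * (q * (q * x) * a)
      pull′ = solve-∀

  eval-dot : ∀ {ℓ m r} (fs : Fin r → Mat ℓ m) x M →
    dot x (λ t → eval (fs t) M) ≡ eval (span fs x) M
  eval-dot {r = r} fs x M = begin
    dot x (λ t → eval (fs t) M)
      ≡⟨ dot-sumF (λ t i → sumF (λ j → fs t i j ⊗ M i j)) ⟩
    sumF (λ i → dot x (λ t → sumF (λ j → fs t i j ⊗ M i j)))
      ≡⟨ sumF-cong (λ i → dot-sumF (λ t j → fs t i j ⊗ M i j)) ⟩
    sumF (λ i → sumF (λ j → dot x (λ t → fs t i j ⊗ M i j)))
      ≡⟨ sumF-cong (λ i → sumF-cong (λ j → dot-⊗ʳ (λ t → fs t i j) (M i j))) ⟩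
    eval (span fs x) M ∎
    where
    open ≡-Reasoning
    dot-sumF : ∀ {k} (g : Fin r → Fin k → K) →
      dot x (λ t → sumF (g t)) ≡ sumF (λ i → dot x (λ t → g t i))
    dot-sumF g = trans (sumF-cong (λ t → sym (sumF-⊗ (lookup x t) (g t))))
      (sumF-swap (λ t i → lookup x t ⊗ g t i))
    dot-⊗ʳ : ∀ (a : Fin r → K) c → dot x (λ t → a t ⊗ c) ≡ dot x a ⊗ c
    dot-⊗ʳ a c = begin
      dot x (λ t → a t ⊗ c)             ≡⟨ sumF-cong (λ t → solve 3 (λ x a c → x :* (a :* c) := c :* (x :* a)) refl (lookup x t) (a t) c) ⟩
      sumF (λ t → c ⊗ (lookup x t ⊗ a t)) ≡⟨ sumF-⊗ c (λ t → lookup x t ⊗ a t) ⟩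
      c ⊗ dot x a                       ≡⟨ ⊗-comm c _ ⟩
      dot x a ⊗ c                       ∎

  eval-zero : ∀ {ℓ m} (N M : Mat ℓ m) → (∀ i j → N i j ≡ 0F) → eval N M ≡ 0F
  eval-zero {ℓ} {m} N M N≡0 = trans
    (sumF-cong (λ i → trans
      (sumF-cong (λ j → trans (cong (_⊗ M i j) (N≡0 i j)) (⊗-zeroˡ (M i j)))) (sumF-0 m)))
    (sumF-0 ℓ)

  q∸1≡p : q ∸ 1 ≡ p
  q∸1≡p = cong (_∸ 1) q≡1+p

  suc-∸1 : ∀ {n} → .{{NonZero n}} → suc (n ∸ 1) ≡ n
  suc-∸1 {suc n} = refl

  module _ {ℓ m n : ℕ} (reps : Fin n → Mat ℓ m) (isReps : IsProjRankOneReps ℓ m n reps) where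

    -- Evaluation is linear, so a combination of forms that is the zero matrix has the zero
    -- codeword, and independence of codewords applies.
    linIndep⇒independent : ∀ {r} (fs : Fin r → Mat ℓ m) → LinIndep reps fs →
      ∀ x → (∀ i j → span fs x i j ≡ 0F) → x ≡ 0ᵛ
    linIndep⇒independent fs linIndep x zero-matrix = lookup-ext λ t → trans
      (linIndep (lookup x)
        (λ k → trans (eval-dot fs x (reps k)) (eval-zero (span fs x) (reps k) zero-matrix)) t)
      (sym (lookup-replicate t 0F))

    -- Both sides carry the factor (q - 1) q^(r+1), since the exponent ℓ + m - r - 1 may be
    -- negative. The bound concerns every independent family, so it also yields minimality for the
    -- family that attains it.
    supportWeight-bound : 2 ≤ ℓ → ℓ ≤ m → ∀ r → suc m ≤ r → (fs : Fin r → Mat ℓ m) →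
      LinIndep reps fs → ∀ s → SupportWeight reps fs s →
      q ^ (ℓ + m) * ((q ^ r ∸ 1) + (q ^ (r ∸ 2) ∸ 1) * (q ∸ 1)) ≤ s * ((q ∸ 1) * q ^ suc r)
    -- Here m would be 0. Beyond this case q ^ (r ∸ 2) involves no truncation.
    supportWeight-bound 2≤ℓ ℓ≤m (suc zero) (s≤s m≤0) fs linIndep s weight =
      contradiction (≤-trans 2≤ℓ (≤-trans ℓ≤m m≤0)) λ ()
    supportWeight-bound 2≤ℓ ℓ≤m (suc (suc r)) (s≤s m≤1+r) fs linIndep s weight
      rewrite q∸1≡p | ^-distribˡ-+-* q ℓ m =
      average-bound q p x E (q ^ ℓ) (q ^ m)
        (∑ (λ y → count (λ u → ¬? (leftKernel? (span fs y) u))))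
        (∑ (λ y → count (leftKernel? (span fs y))))
        (count (λ y → rankAtMostOne? (span fs y)))
        s q≡1+p _ E+q
        (trans (cong (q ^ suc (suc r) *_) (sym (supportWeight-count fs reps isReps s weight)))
          (weight-identity fs))
        (image-sum fs)
        (kernel-sum fs independent)
        (rank≤1-count fs independent (suc r) refl ℓ≤m m≤1+r)
      where
      x E : ℕ
      x = q ^ r
      E = (q * (q * x) ∸ 1) + (x ∸ 1) * p
      independent : ∀ y → (∀ i j → span fs y i j ≡ 0F) → y ≡ 0ᵛ
      independent = linIndep⇒independent fs linIndep
      rearrange : ∀ y z p → y + z * p + suc p ≡ suc y + suc z * p
      rearrange = solve-∀
      E+q : E + q ≡ q * (q * x) + x * p
      E+q = begin
        E + q
          ≡⟨ cong (E +_) q≡1+p ⟩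
        (q * (q * x) ∸ 1) + (x ∸ 1) * p + suc p
          ≡⟨ rearrange (q * (q * x) ∸ 1) (x ∸ 1) p ⟩
        suc (q * (q * x) ∸ 1) + suc (x ∸ 1) * p
          ≡⟨ cong₂ (λ y z → y + z * p) (suc-∸1 {{m^n≢0 q (suc (suc r))}}) (suc-∸1 {{m^n≢0 q r}}) ⟩
        q * (q * x) + x * p ∎
        where open ≡-Reasoning

  -- With b = q^m and c = q^(r-m) this is bc - 1 = c (b - 1) + (c - 1), multiplied out; the first
  -- summand accounts for the m-th weight. The term `C` is carried along unchanged.
  weight-bound-decomposition : ∀ ℓ m r C → 1 ≤ ℓ → m ≤ r →
    q ^ (ℓ + m) * ((q ^ r ∸ 1) + C) ≡
    q ^ suc r * (q ^ (ℓ ∸ 1) * (q ^ m ∸ 1)) + q ^ (ℓ + m) * ((q ^ (r ∸ m) ∸ 1) + C)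
  weight-bound-decomposition (suc ℓ) m r C _ m≤r
    with t , refl ← m≤n⇒∃[o]m+o≡n m≤r
    rewrite m+n∸m≡n m t | ^-distribˡ-+-* q ℓ m | ^-distribˡ-+-* q m t =
    identity q (q ^ ℓ) (q ^ m) (q ^ t) C (m^n≢0 q m) (m^n≢0 q t)
    where
    identity : ∀ q a b c C → NonZero b → NonZero c →
      q * (a * b) * ((b * c ∸ 1) + C) ≡ q * (b * c) * (a * (b ∸ 1)) + q * (a * b) * ((c ∸ 1) + C)
    identity q a (suc b) (suc c) C _ _ = polynomial q a b c C
      where
      polynomial : ∀ q a b c C → q * (a * suc b) * (c + b * suc c + C) ≡
        q * (suc b * suc c) * (a * b) + q * (a * suc b) * (c + C)
      polynomial = solve-∀

  -- A subcode attaining the bound for r = m + 1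

  ∑-head : ∀ {n} (g : K → ℕ) → ∑ {Vec K (suc n)} (λ v → g (lookup v zero)) ≡ ∑ g * q ^ n
  ∑-head {n} g = begin
    ∑ {Vec K (suc n)} (λ v → g (lookup v zero))  ≡⟨ ∑-∷ {K} {n} (λ v → g (lookup v zero)) ⟩
    ∑ {K} (λ c → ∑ {Vec K n} (λ _ → g c))        ≡⟨ ∑-cong {K} (λ c → trans (∑-const {Vec K n} (g c))
                                                    (trans (cong (_* g c) (card-Kⁿ n)) (*-comm (q ^ n) (g c)))) ⟩
    ∑ {K} (λ c → g c * q ^ n)                    ≡⟨ ∑-*ʳ {K} g (q ^ n) ⟩
    ∑ g * q ^ n                                  ∎
    where open ≡-Reasoning

  matrixUnit : ∀ {ℓ m} → Fin ℓ → Fin m → Mat ℓ m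
  matrixUnit i j = outer (unit i) (unit j)

  eval-matrixUnit : ∀ {ℓ m} (i : Fin ℓ) (j : Fin m) M → eval (matrixUnit i j) M ≡ M i j
  eval-matrixUnit i j M = begin
    eval (matrixUnit i j) M
      ≡⟨ sumF-cong (λ i′ → trans (sumF-cong (λ j′ → ⊗-assoc (lookup (unit i) i′) (lookup (unit j) j′) (M i′ j′)))
           (sumF-⊗ (lookup (unit i) i′) (λ j′ → lookup (unit j) j′ ⊗ M i′ j′))) ⟩
    dot (unit i) (λ i′ → dot (unit j) (M i′))
      ≡⟨ dot-unit i _ ⟩
    dot (unit j) (M i)
      ≡⟨ dot-unit j (M i) ⟩
    M i j ∎
    where open ≡-Reasoning

  1≢0 : 1F ≢ 0F
  1≢0 eq = 0≢1 (sym eq)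

  matrixUnit-rankOne : ∀ {ℓ m} (i : Fin ℓ) (j : Fin m) → RankOne (matrixUnit i j)
  matrixUnit-rankOne i j = outer-rankOne (unit i) (unit j) i j
    (subst (_≢ 0F) (sym (lookup-unit i)) 1≢0) (subst (_≢ 0F) (sym (lookup-unit j)) 1≢0)

  module _ {ℓ m n r : ℕ} (reps : Fin n → Mat ℓ m) (isReps : IsProjRankOneReps ℓ m n reps)
           (fs : Fin r → Mat ℓ m) where

    zeroWord? : ∀ k → Dec (∀ t → codeword reps (fs t) k ≡ 0F)
    zeroWord? k = Fin.all? λ t → codeword reps (fs t) k ≟ 0F

    support : Subset n
    support = tabulate (λ k → does (¬? (zeroWord? k)))

    supportWeight : SupportWeight reps fs ∣ support ∣
    supportWeight = support , (λ k → to k , from k) , refl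
      where
      to : ∀ k → k ∈ support → InSupport reps fs k
      to k k∈ = inSupport fs reps isReps k λ zero-word →
        contradiction (trans (sym ([]=⇒lookup k∈)) (lookup∘tabulate _ k))
          (λ eq → contradiction (trans eq (dec-false (¬? (zeroWord? k)) (λ ¬zero → ¬zero zero-word))) λ ())
      from : ∀ k → InSupport reps fs k → k ∈ support
      from k supported = lookup⇒[]= k support (trans (lookup∘tabulate _ k)
        (dec-true (¬? (zeroWord? k)) (support⇒¬zero fs reps isReps k supported)))

    -- Every matrix of rank one is a multiple of a representative. This permits evaluation at matrix
    -- units, which need not be among the representatives.
    combo-rankOne : ∀ λs → (∀ k → combo reps fs λs k ≡ 0F) →
      ∀ M → RankOne M → sumF (λ t → λs t ⊗ eval (fs t) M) ≡ 0F
    combo-rankOne λs zero-combo M rankOne =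
      let k , c , _ , M≡cR = proj₁ (proj₂ isReps) M rankOne in begin
      sumF (λ t → λs t ⊗ eval (fs t) M)
        ≡⟨ sumF-cong (λ t → trans (cong (λs t ⊗_) (eval-scalar (fs t) c M≡cR))
             (solve 3 (λ x c y → x :* (c :* y) := c :* (x :* y)) refl (λs t) c (eval (fs t) (reps k)))) ⟩
      sumF (λ t → c ⊗ (λs t ⊗ eval (fs t) (reps k)))
        ≡⟨ sumF-⊗ c (λ t → λs t ⊗ eval (fs t) (reps k)) ⟩
      c ⊗ combo reps fs λs k
        ≡⟨ trans (cong (c ⊗_) (zero-combo k)) (⊗-zeroʳ c) ⟩
      0F ∎
      where open ≡-Reasoning

  module Extremal (l k : ℕ) where

    private
      ℓ m : ℕ
      ℓ = suc (suc l)
      m = suc k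

    -- All estimates are sharp here. The matrices supported in the first row form a D_u with A =
    -- q^m, the upper end of the interval for A; each other coset contains exactly q matrices of
    -- rank one; and no rank exceeds two.
    fs : Fin (suc m) → Mat ℓ m
    fs zero    = matrixUnit (suc zero) zero
    fs (suc j) = matrixUnit zero j

    NonVanishing : Vec K ℓ × Vec K m → Set
    NonVanishing s = ¬ Vanishing fs s

    eval-fs-zero : ∀ M → eval (fs zero) M ≡ M (suc zero) zero
    eval-fs-zero = eval-matrixUnit (suc zero) zero

    eval-fs-suc : ∀ j M → eval (fs (suc j)) M ≡ M zero j
    eval-fs-suc j = eval-matrixUnit zero j

    -- The forms take the values u₀ v_j and u₁ v₀. If u₀ is nonzero they all vanish only for v = 0;
    -- otherwise only u₁ v₀ remains. Each summand is a function of `u` times a function of `v`, so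
    -- the double sum factors.
    nonvanishing-indicator : ∀ u v (nv? : Dec (NonVanishing (u , v))) → 𝟙 nv? ≡
      𝟙 (¬? (lookup u zero ≟ 0F)) * 𝟙 (¬? (v ≟ 0ᵛ)) +
      𝟙 (lookup u zero ≟ 0F) * 𝟙 (¬? (lookup u (suc zero) ≟ 0F)) * 𝟙 (¬? (lookup v zero ≟ 0F))
    nonvanishing-indicator u v nv? with lookup u zero ≟ 0F
    ... | no u₀≢0 = trans (𝟙-cong nv? (¬? (v ≟ 0ᵛ))
        (λ nonvanishing v≡0 → nonvanishing λ t → trans (eval-outer (fs t) u v)
          (trans (cong (λ w → dot u (λ i → dot w (fs t i))) v≡0)
            (dot-zero u (λ i → dot-0ᵛ (fs t i)))))
        (λ v≢0 vanishing → let j , vj≢0 = nonzero-entry v v≢0 in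
          ⊗-≢0 u₀≢0 vj≢0 (trans (sym (eval-fs-suc j (outer u v))) (vanishing (suc j)))))
      (sym (trans (+-identityʳ _) (*-identityˡ (𝟙 (¬? (v ≟ 0ᵛ))))))
    ... | yes u₀≡0 = trans (𝟙-cong nv? (¬? (lookup u (suc zero) ≟ 0F) ×-dec ¬? (lookup v zero ≟ 0F))
        (λ nonvanishing →
          (λ u₁≡0 → nonvanishing (vanish (trans (cong (_⊗ lookup v zero) u₁≡0) (⊗-zeroˡ _)))) ,
          (λ v₀≡0 → nonvanishing (vanish (trans (cong (lookup u (suc zero) ⊗_) v₀≡0) (⊗-zeroʳ _)))))
        (λ (u₁≢0 , v₀≢0) vanishing →
          ⊗-≢0 u₁≢0 v₀≢0 (trans (sym (eval-fs-zero (outer u v))) (vanishing zero))))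
      (trans (𝟙-× (¬? (lookup u (suc zero) ≟ 0F)) (¬? (lookup v zero ≟ 0F)))
        (cong (_* 𝟙 (¬? (lookup v zero ≟ 0F)))
          (sym (*-identityˡ (𝟙 (¬? (lookup u (suc zero) ≟ 0F)))))))
      where
      vanish : lookup u (suc zero) ⊗ lookup v zero ≡ 0F → Vanishing fs (u , v)
      vanish eq zero    = trans (eval-fs-zero (outer u v)) eq
      vanish eq (suc j) = trans (eval-fs-suc j (outer u v))
        (trans (cong (_⊗ lookup v j) u₀≡0) (⊗-zeroˡ _))

    count-nonvanishing : count (λ s → ¬? (vanishing? fs s)) ≡
      p * (q ^ suc l * (q ^ m ∸ 1) + p * q ^ (l + k))
    count-nonvanishing = begin
      count (λ s → ¬? (vanishing? fs s))
        ≡⟨ ∑-× (λ s → 𝟙 (¬? (vanishing? fs s))) ⟩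
      ∑ {Vec K ℓ} (λ u → ∑ {Vec K m} (λ v → 𝟙 (¬? (vanishing? fs (u , v)))))
        ≡⟨ ∑-cong {Vec K ℓ} (λ u → ∑-cong {Vec K m} (λ v → nonvanishing-indicator u v (¬? (vanishing? fs (u , v))))) ⟩
      ∑ {Vec K ℓ} (λ u → ∑ {Vec K m} (λ v → a u * b v + a′ u * b′ v))
        ≡⟨ ∑-cong {Vec K ℓ} (λ u → trans (∑-+ {Vec K m} (λ v → a u * b v) (λ v → a′ u * b′ v))
             (cong₂ _+_ (∑-*ˡ {Vec K m} (a u) b) (∑-*ˡ {Vec K m} (a′ u) b′))) ⟩
      ∑ {Vec K ℓ} (λ u → a u * ∑ b + a′ u * ∑ b′)
        ≡⟨ trans (∑-+ {Vec K ℓ} (λ u → a u * ∑ b) (λ u → a′ u * ∑ b′))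
             (cong₂ _+_ (∑-*ʳ {Vec K ℓ} a (∑ b)) (∑-*ʳ {Vec K ℓ} a′ (∑ b′))) ⟩
      ∑ a * ∑ b + ∑ a′ * ∑ b′
        ≡⟨ cong₂ _+_ (cong₂ _*_ ∑a ∑b) (cong₂ _*_ ∑a′ ∑b′) ⟩
      p * q ^ suc l * (q ^ m ∸ 1) + p * q ^ l * (p * q ^ k)
        ≡⟨ regroup p (q ^ suc l) (q ^ m ∸ 1) (q ^ l) (q ^ k) ⟩
      p * (q ^ suc l * (q ^ m ∸ 1) + p * (q ^ l * q ^ k))
        ≡⟨ cong (λ y → p * (q ^ suc l * (q ^ m ∸ 1) + p * y)) (sym (^-distribˡ-+-* q l k)) ⟩
      p * (q ^ suc l * (q ^ m ∸ 1) + p * q ^ (l + k)) ∎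
      where
      open ≡-Reasoning
      nz z : K → ℕ
      nz c = 𝟙 (¬? (c ≟ 0F))
      z c = 𝟙 (c ≟ 0F)
      a a′ : Vec K ℓ → ℕ
      a u = nz (lookup u zero)
      a′ u = z (lookup u zero) * nz (lookup u (suc zero))
      b b′ : Vec K m → ℕ
      b v = 𝟙 (¬? (v ≟ 0ᵛ))
      b′ v = nz (lookup v zero)
      regroup : ∀ p a b c d → p * a * b + p * c * (p * d) ≡ p * (a * b + p * (c * d))
      regroup = solve-∀
      ∑a : ∑ a ≡ p * q ^ suc l
      ∑a = trans (∑-head nz) (cong (_* q ^ suc l) count-nonzero)
      ∑b′ : ∑ b′ ≡ p * q ^ k
      ∑b′ = trans (∑-head nz) (cong (_* q ^ k) count-nonzero)
      ∑b : ∑ b ≡ q ^ m ∸ 1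
      ∑b = cong (_∸ 1) (begin
        suc (∑ b)
          ≡⟨ cong (_+ ∑ b) (sym (Finite.once finite-Vec 0ᵛ)) ⟩
        count (λ (v : Vec K m) → v ≟ 0ᵛ) + ∑ b
          ≡⟨ count-¬ (λ (v : Vec K m) → v ≟ 0ᵛ) ⟩
        card (Vec K m)
          ≡⟨ card-Kⁿ m ⟩
        q ^ m ∎)
      ∑a′ : ∑ a′ ≡ p * q ^ l
      ∑a′ = begin
        ∑ a′
          ≡⟨ ∑-∷ {K} {suc l} a′ ⟩
        ∑ {K} (λ c → ∑ {Vec K (suc l)} (λ v → z c * nz (lookup v zero)))
          ≡⟨ ∑-cong {K} (λ c → ∑-*ˡ {Vec K (suc l)} (z c) (λ v → nz (lookup v zero))) ⟩
        ∑ {K} (λ c → z c * ∑ {Vec K (suc l)} (λ v → nz (lookup v zero)))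
          ≡⟨ ∑-*ʳ {K} z _ ⟩
        ∑ z * ∑ {Vec K (suc l)} (λ v → nz (lookup v zero))
          ≡⟨ cong₂ _*_ (Finite.once finite-K 0F) (∑-head nz) ⟩
        1 * (count (λ c → ¬? (c ≟ 0F)) * q ^ l)
          ≡⟨ trans (*-identityˡ _) (cong (_* q ^ l) count-nonzero) ⟩
        p * q ^ l ∎

    module _ {n : ℕ} (reps : Fin n → Mat ℓ m) (isReps : IsProjRankOneReps ℓ m n reps) where

      linIndep : LinIndep reps fs
      linIndep λs zero-combo = vanish
        where
        open ≡-Reasoning
        -- Each of the chosen matrix units is seen by one form only: the unit at `(suc zero, zero)`
        -- isolates `λs zero`, and the unit at `(zero, j)` isolates `λs (suc j)`.
        at : ∀ i j → λs zero ⊗ matrixUnit {ℓ} {m} i j (suc zero) zero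
          ⊕ sumF (λ j′ → λs (suc j′) ⊗ matrixUnit {ℓ} {m} i j zero j′) ≡ 0F
        at i j = trans
          (cong₂ _⊕_ (cong (λs zero ⊗_) (sym (eval-fs-zero (matrixUnit i j))))
            (sumF-cong (λ j′ → cong (λs (suc j′) ⊗_) (sym (eval-fs-suc j′ (matrixUnit i j))))))
          (combo-rankOne reps isReps fs λs zero-combo (matrixUnit i j) (matrixUnit-rankOne i j))
        vanish : ∀ t → λs t ≡ 0F
        vanish zero = begin
          λs zero
            ≡⟨ sym (trans (⊕-identityʳ _) (trans (cong (λs zero ⊗_) (⊗-identityˡ 1F)) (⊗-identityʳ (λs zero)))) ⟩
          λs zero ⊗ (1F ⊗ 1F) ⊕ 0F
            ≡⟨ cong (λs zero ⊗ (1F ⊗ 1F) ⊕_) (sym (trans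
                 (sumF-cong (λ j′ → trans (cong (λs (suc j′) ⊗_) (⊗-zeroˡ (lookup (unit {m} zero) j′))) (⊗-zeroʳ _))) (sumF-0 m))) ⟩
          λs zero ⊗ (1F ⊗ 1F) ⊕ sumF (λ j′ → λs (suc j′) ⊗ matrixUnit {ℓ} {m} (suc zero) zero zero j′)
            ≡⟨ at (suc zero) zero ⟩
          0F ∎
        vanish (suc j) = begin
          λs (suc j)
            ≡⟨ sym (dot-unit j (λ j′ → λs (suc j′))) ⟩
          dot (unit j) (λ j′ → λs (suc j′))
            ≡⟨ sumF-cong (λ j′ → trans (⊗-comm _ _) (cong (λs (suc j′) ⊗_) (sym (⊗-identityˡ (lookup (unit j) j′))))) ⟩
          sumF (λ j′ → λs (suc j′) ⊗ matrixUnit {ℓ} {m} zero j zero j′)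
            ≡⟨ sym (⊕-identityˡ _) ⟩
          0F ⊕ sumF (λ j′ → λs (suc j′) ⊗ matrixUnit {ℓ} {m} zero j zero j′)
            ≡⟨ cong (_⊕ sumF (λ j′ → λs (suc j′) ⊗ matrixUnit {ℓ} {m} zero j zero j′))
                 (sym (trans (cong (λs zero ⊗_) (⊗-zeroˡ (lookup (unit j) zero))) (⊗-zeroʳ _))) ⟩
          λs zero ⊗ matrixUnit {ℓ} {m} zero j (suc zero) zero
            ⊕ sumF (λ j′ → λs (suc j′) ⊗ matrixUnit {ℓ} {m} zero j zero j′)
            ≡⟨ at zero j ⟩
          0F ∎

      d : ℕ
      d = ∣ support reps isReps fs ∣

      p*d : p * d ≡ q ^ suc l * (q ^ m ∸ 1) + p * q ^ (l + k)
      p*d = *-cancelˡ-≡ (p * d) _ p (begin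
        p * (p * d)     ≡⟨ rearrange p d ⟩
        d * (p * p)     ≡⟨ sym (supportWeight-count fs reps isReps d (supportWeight reps isReps fs)) ⟩
        count (λ s → ¬? (vanishing? fs s)) ≡⟨ count-nonvanishing ⟩
        p * (q ^ suc l * (q ^ m ∸ 1) + p * q ^ (l + k)) ∎)
        where
        open ≡-Reasoning
        rearrange : ∀ p d → p * (p * d) ≡ d * (p * p)
        rearrange = solve-∀

      -- For r = m + 1 the second bracket is (q - 1) + (q^(m-1) - 1)(q - 1) = q^(m-1) (q - 1), so
      -- the lower bound collapses to the weight computed in `p*d`.
      bound-at-suc-m : q ^ (ℓ + m) * ((q ^ suc m ∸ 1) + (q ^ (suc m ∸ 2) ∸ 1) * (q ∸ 1)) ≡
        d * ((q ∸ 1) * q ^ suc (suc m))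
      bound-at-suc-m = begin
        q ^ (ℓ + m) * ((q ^ suc m ∸ 1) + (q ^ k ∸ 1) * (q ∸ 1))
          ≡⟨ weight-bound-decomposition ℓ m (suc m) ((q ^ k ∸ 1) * (q ∸ 1)) (s≤s z≤n) (n≤1+n m) ⟩
        q ^ suc (suc m) * (q ^ suc l * (q ^ m ∸ 1)) + q ^ (ℓ + m) * ((q ^ (suc m ∸ m) ∸ 1) + (q ^ k ∸ 1) * (q ∸ 1))
          ≡⟨ cong (λ e → q ^ suc (suc m) * (q ^ suc l * (q ^ m ∸ 1)) + q ^ (ℓ + m) * e) tail ⟩
        q ^ suc (suc m) * (q ^ suc l * (q ^ m ∸ 1)) + q ^ (ℓ + m) * (q ^ k * p)
          ≡⟨ cong (q ^ suc (suc m) * (q ^ suc l * (q ^ m ∸ 1)) +_) exponents ⟩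
        q ^ suc (suc m) * (q ^ suc l * (q ^ m ∸ 1)) + q ^ suc (suc m) * (p * q ^ (l + k))
          ≡⟨ sym (*-distribˡ-+ (q ^ suc (suc m)) _ _) ⟩
        q ^ suc (suc m) * (q ^ suc l * (q ^ m ∸ 1) + p * q ^ (l + k))
          ≡⟨ cong (q ^ suc (suc m) *_) (sym p*d) ⟩
        q ^ suc (suc m) * (p * d)
          ≡⟨ rearrange (q ^ suc (suc m)) p d ⟩
        d * (p * q ^ suc (suc m))
          ≡⟨ cong (λ e → d * (e * q ^ suc (suc m))) (sym q∸1≡p) ⟩
        d * ((q ∸ 1) * q ^ suc (suc m)) ∎
        where
        open ≡-Reasoning
        rearrange : ∀ y p d → y * (p * d) ≡ d * (p * y)
        rearrange = solve-∀
        tail : (q ^ (suc m ∸ m) ∸ 1) + (q ^ k ∸ 1) * (q ∸ 1) ≡ q ^ k * p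
        tail = begin
          (q ^ (suc m ∸ m) ∸ 1) + (q ^ k ∸ 1) * (q ∸ 1)
            ≡⟨ cong₂ (λ e f → (q ^ e ∸ 1) + (q ^ k ∸ 1) * f) (m+n∸n≡m 1 m) q∸1≡p ⟩
          (q ^ 1 ∸ 1) + (q ^ k ∸ 1) * p
            ≡⟨ cong (λ e → (e ∸ 1) + (q ^ k ∸ 1) * p) (*-identityʳ q) ⟩
          (q ∸ 1) + (q ^ k ∸ 1) * p
            ≡⟨ cong (_+ (q ^ k ∸ 1) * p) q∸1≡p ⟩
          suc (q ^ k ∸ 1) * p
            ≡⟨ cong (_* p) (suc-∸1 {{m^n≢0 q k}}) ⟩
          q ^ k * p ∎
        exponents : q ^ (ℓ + m) * (q ^ k * p) ≡ q ^ suc (suc m) * (p * q ^ (l + k))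
        exponents
          rewrite ^-distribˡ-+-* q l m | ^-distribˡ-+-* q l k =
          polynomial q p (q ^ l) (q ^ k)
          where
          polynomial : ∀ q p a b → q * (q * (a * (q * b))) * (b * p) ≡ q * (q * (q * b)) * (p * (a * b))
          polynomial = solve-∀

      isGHW : ℓ ≤ m → IsGHW reps (suc m) d
      isGHW ℓ≤m = (fs , linIndep , supportWeight reps isReps fs) , minimal
        where
        minimal : ∀ gs → LinIndep reps gs → ∀ s → SupportWeight reps gs s → d ≤ s
        minimal gs gs-linIndep s weight =
          *-cancelʳ-≤ d s ((q ∸ 1) * q ^ suc (suc m)) {{m*n≢0 (q ∸ 1) (q ^ suc (suc m))
            {{subst NonZero (sym q∸1≡p) _}} {{m^n≢0 q (suc (suc m))}}}}
            (subst (_≤ s * ((q ∸ 1) * q ^ suc (suc m))) bound-at-suc-m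
              (supportWeight-bound reps isReps (s≤s (s≤s z≤n)) ℓ≤m (suc m) ≤-refl gs gs-linIndep s weight))

theorem4p9 : (F : FiniteField) → (ℓ m : ℕ) → 2 ≤ ℓ → ℓ ≤ m →
    (n : ℕ) → (reps : Fin n → Code.Mat F ℓ m) →
    Code.IsProjRankOneReps F ℓ m n reps →
    let q = FiniteField.size F in
    ((r : ℕ) → suc m ≤ r → r ≤ ℓ * m →
    (∀ d → Code.IsGHW F reps r d →
    q ^ (ℓ + m) * ((q ^ r ∸ 1) + (q ^ (r ∸ 2) ∸ 1) * (q ∸ 1))
    ≤ d * ((q ∸ 1) * q ^ (suc r))) ×
    (q ^ (ℓ + m) * ((q ^ r ∸ 1) + (q ^ (r ∸ 2) ∸ 1) * (q ∸ 1))
    ≡ q ^ (suc r) * (q ^ (ℓ ∸ 1) * (q ^ m ∸ 1))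
    + q ^ (ℓ + m) * ((q ^ (r ∸ m) ∸ 1) + (q ^ (r ∸ 2) ∸ 1) * (q ∸ 1)))) ×
    (Σ ℕ λ d → Code.IsGHW F reps (suc m) d ×
    ((q ∸ 1) * d ≡ q ^ (ℓ ∸ 1) * (q ^ m ∸ 1) + (q ∸ 1) * q ^ (ℓ + m ∸ 3)))
theorem4p9 F (suc (suc l)) (suc k) 2≤ℓ@(s≤s (s≤s _)) ℓ≤m n reps isReps =
  (λ r m<r _ →
    (λ { d ((fs , linIndep , weight) , _) →
           supportWeight-bound reps isReps 2≤ℓ ℓ≤m r m<r fs linIndep d weight }) ,
    weight-bound-decomposition (suc (suc l)) (suc k) r ((q ^ (r ∸ 2) ∸ 1) * (q ∸ 1)) (s≤s z≤n)
      (≤-trans (n≤1+n (suc k)) m<r)) ,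
  d reps isReps , isGHW reps isReps ℓ≤m , (begin
    (q ∸ 1) * d reps isReps
      ≡⟨ cong (_* d reps isReps) q∸1≡p ⟩
    p * d reps isReps
      ≡⟨ p*d reps isReps ⟩
    q ^ suc l * (q ^ suc k ∸ 1) + p * q ^ (l + k)
      -- The exponent suc (suc l) + suc k ∸ 3 computes to l + suc k ∸ 1, so one use of `+-suc`
      -- brings it to l + k.
      ≡⟨ cong₂ (λ e f → q ^ suc l * (q ^ suc k ∸ 1) + e * q ^ f) (sym q∸1≡p) (sym (cong (_∸ 1) (+-suc l k))) ⟩
    q ^ suc l * (q ^ suc k ∸ 1) + (q ∸ 1) * q ^ (suc (suc l) + suc k ∸ 3) ∎)
  where
  open ≡-Reasoning
  open FiniteField F using () renaming (size to q)
  open LinearAlgebra F using (p)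
  open GeneralizedWeights F
  open Extremal l k
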